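{- For each $n\ge 5$, $P_n^3\times\overleftrightarrow{K_2}$ and $P_n^4\times\overleftrightarrow{K_2}$ form a pair of noncospectral equienergetic sidigraphs, each of order $2n$ and with energy equal to $2n$.
   Context: A sidigraph (signed digraph) is a pair $S=(D,\sigma)$, where $D=(V,\mathscr{A})$ is a digraph and $\sigma:\mathscr{A}\to\{ -1,1\}$. Its adjacency matrix $A(S)=(a_{ij})$ has $a_{ij}=\sigma(v_i,v_j)$ if there is an arc from $v_i$ to $v_j$ and $0$ otherwise. The energy of $S$ is $E(S)=\sum_j|\Re z_j|$, where the $z_j$ are the eigenvalues of $A(S)$ with multiplicity. Two sidigraphs on the same number of vertices are cospectral if they have the same spectrum (with multiplicities); two nonisomorphic sidigraphs of the same order are equienergetic if they have equal energy. $\mathbf{C}_l$ is a negative directed cycle on $l$ vertices (product of arc signs equal to $-1$). The path $P_m$ ($m\ge2$) is the sidigraph on vertices $v_1,\dots,v_m$ with signed arcs $(v_i,v_{i+1})$, $1\le i\le m-1$. For $n\ge l+1$, $P_n^l$ is a sidigraph on $n$ vertices obtained by identifying one pendant vertex (end vertex) of the path $P_{n-l+1}$ with any vertex of $\mathbf{C}_l$; the signs of the non-cyclic arcs are arbitrary. $\overleftrightarrow{K_2}$ is the symmetric digraph on two vertices $u,v$ with arcs $(u,v)$ and $(v,u)$, both positive. The cartesian product $S_1\times S_2$ of $S_1=(V_1,A_1,\sigma_1)$ and $S_2=(V_2,A_2,\sigma_2)$ is the sidigraph on $V_1\times V_2$ with an arc from $(u_i,v_j)$ to $(u_k,v_l)$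 iff either $j=l$ and $(u_i,u_k)\in A_1$ (with sign $\sigma_1(u_i,u_k)$), or $i=k$ and $(v_j,v_l)\in A_2$ (with sign $\sigma_2(v_j,v_l)$). -}

module Defs where

open import Algebra.Bundles.Raw using (RawRing)
import Algebra.Definitions.RawMonoid as RawMonoidDefs
import Algebra.Definitions.RawSemiring as RawSemiringDefs
open import Data.Fin.Base as Fin using (Fin; zero; suc; toℕ; fromℕ; punchIn; remQuot; splitAt)
open import Data.Fin.Properties using () renaming (_≟_ to _≟ᶠ_)
import Data.Integer.Base as ℤ
open import Data.Maybe.Base using (Maybe; just; nothing; maybe′; _<∣>_)
open import Data.Nat.Base as ℕ using (ℕ; zero; suc)
import Data.Nat.Properties as ℕₚ
open import Data.Product.Base using (Σ-syntax; ∃-syntax; _×_; _,_; proj₁; proj₂)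
open import Data.Rational.Base as ℚ using (ℚ; 0ℚ; 1ℚ; ½)
import Data.Rational.Properties as ℚₚ
open import Data.Rational.Solver using (module +-*-Solver)
open import Data.Sign.Base as Sign using (Sign)
open import Data.Sum.Base using (_⊎_; inj₁; inj₂)
open import Data.Vec.Functional as Vector using (Vector)
open import Function.Bundles using (_↔_; Inverse)
open import Level using (0ℓ; _⊔_)
open import Relation.Binary.PropositionalEquality
open import Relation.Nullary using (¬_; yes; no)
open import Relation.Nullary.Decidable using (⌊_⌋)
open import Data.Bool.Base using (if_then_else_)

------------------------------------------------------------------------
-- Real numbers: Cauchy sequences of rationals, with pointwise operations
-- and the relation "the difference tends to 0" as equality.

Cauchy : (ℕ → ℚ) → Set
Cauchy x = ∀ ε → 0ℚ ℚ.< ε →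
  ∃[ N ] (∀ m n → N ℕ.≤ m → N ℕ.≤ n → ℚ.∣ x m ℚ.- x n ∣ ℚ.< ε)

record ℝ : Set where
  constructor mkℝ
  field
    seq    : ℕ → ℚ
    cauchy : Cauchy seq

open ℝ public

infix 4 _≈ℝ_
_≈ℝ_ : ℝ → ℝ → Set
x ≈ℝ y = ∀ ε → 0ℚ ℚ.< ε →
  ∃[ N ] (∀ n → N ℕ.≤ n → ℚ.∣ seq x n ℚ.- seq y n ∣ ℚ.< ε)

private abstract
  half-pos : ∀ ε → 0ℚ ℚ.< ε → 0ℚ ℚ.< ½ ℚ.* ε
  half-pos ε 0<ε = subst (ℚ._< ½ ℚ.* ε) (ℚₚ.*-zeroʳ ½) (ℚₚ.*-monoʳ-<-pos ½ 0<ε)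

  half+half : ∀ ε → ½ ℚ.* ε ℚ.+ ½ ℚ.* ε ≡ ε
  half+half ε = trans (sym (ℚₚ.*-distribʳ-+ ε ½ ½)) (ℚₚ.*-identityˡ ε)

  ∣p-q∣≡∣q-p∣ : ∀ p q → ℚ.∣ p ℚ.- q ∣ ≡ ℚ.∣ q ℚ.- p ∣
  ∣p-q∣≡∣q-p∣ p q = trans (sym (ℚₚ.∣-p∣≡∣p∣ (p ℚ.- q))) (cong ℚ.∣_∣ (eq p q))
    where
    open +-*-Solver
    eq : ∀ p q → ℚ.- (p ℚ.- q) ≡ q ℚ.- p
    eq = solve 2 (λ p q → :- (p :+ :- q) := q :+ :- p) refl

  -- the triangle inequality in the form |p| - |q| ≤ |p - q|
  ∣p∣-∣q∣≤∣p-q∣ : ∀ p q → ℚ.∣ p ∣ ℚ.- ℚ.∣ q ∣ ℚ.≤ ℚ.∣ p ℚ.- q ∣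
  ∣p∣-∣q∣≤∣p-q∣ p q = begin
    ℚ.∣ p ∣ ℚ.- ℚ.∣ q ∣                          ≡⟨ cong (λ r → ℚ.∣ r ∣ ℚ.- ℚ.∣ q ∣) (eq₁ p q) ⟩
    ℚ.∣ (p ℚ.- q) ℚ.+ q ∣ ℚ.- ℚ.∣ q ∣            ≤⟨ ℚₚ.+-monoˡ-≤ (ℚ.- ℚ.∣ q ∣) (ℚₚ.∣p+q∣≤∣p∣+∣q∣ (p ℚ.- q) q) ⟩
    (ℚ.∣ p ℚ.- q ∣ ℚ.+ ℚ.∣ q ∣) ℚ.- ℚ.∣ q ∣      ≡⟨ eq₂ ℚ.∣ p ℚ.- q ∣ ℚ.∣ q ∣ ⟩
    ℚ.∣ p ℚ.- q ∣                                ∎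
    where
    open ℚₚ.≤-Reasoning
    open +-*-Solver
    eq₁ : ∀ p q → p ≡ (p ℚ.- q) ℚ.+ q
    eq₁ = solve 2 (λ p q → p := (p :+ :- q) :+ q) refl
    eq₂ : ∀ a b → (a ℚ.+ b) ℚ.- b ≡ a
    eq₂ = solve 2 (λ a b → (a :+ b) :+ :- b := a) refl

  ∣∣p∣-∣q∣∣≤∣p-q∣ : ∀ p q → ℚ.∣ ℚ.∣ p ∣ ℚ.- ℚ.∣ q ∣ ∣ ℚ.≤ ℚ.∣ p ℚ.- q ∣
  ∣∣p∣-∣q∣∣≤∣p-q∣ p q with ℚₚ.∣p∣≡p∨∣p∣≡-p (ℚ.∣ p ∣ ℚ.- ℚ.∣ q ∣)
  ... | inj₁ e = subst (ℚ._≤ ℚ.∣ p ℚ.- q ∣) (sym e) (∣p∣-∣q∣≤∣p-q∣ p q)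
  ... | inj₂ e = subst₂ ℚ._≤_ (sym (trans e (eq ℚ.∣ p ∣ ℚ.∣ q ∣))) (∣p-q∣≡∣q-p∣ q p)
                   (∣p∣-∣q∣≤∣p-q∣ q p)
    where
    open +-*-Solver
    eq : ∀ a b → ℚ.- (a ℚ.- b) ≡ b ℚ.- a
    eq = solve 2 (λ a b → :- (a :+ :- b) := b :+ :- a) refl

  +-cauchy : ∀ {x y} → Cauchy x → Cauchy y → Cauchy (λ n → x n ℚ.+ y n)
  +-cauchy {x} {y} cx cy ε 0<ε with cx _ (half-pos ε 0<ε) | cy _ (half-pos ε 0<ε)
  ... | N₁ , h₁ | N₂ , h₂ = N₁ ℕ.⊔ N₂ , λ m n N≤m N≤n → begin-strict
    ℚ.∣ (x m ℚ.+ y m) ℚ.- (x n ℚ.+ y n) ∣         ≡⟨ cong ℚ.∣_∣ (eq (x m) (y m) (x n) (y n)) ⟩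
    ℚ.∣ (x m ℚ.- x n) ℚ.+ (y m ℚ.- y n) ∣         ≤⟨ ℚₚ.∣p+q∣≤∣p∣+∣q∣ (x m ℚ.- x n) (y m ℚ.- y n) ⟩
    ℚ.∣ x m ℚ.- x n ∣ ℚ.+ ℚ.∣ y m ℚ.- y n ∣
      <⟨ ℚₚ.+-mono-< (h₁ m n (ℕₚ.m⊔n≤o⇒m≤o N₁ N₂ N≤m) (ℕₚ.m⊔n≤o⇒m≤o N₁ N₂ N≤n))
                     (h₂ m n (ℕₚ.m⊔n≤o⇒n≤o N₁ N₂ N≤m) (ℕₚ.m⊔n≤o⇒n≤o N₁ N₂ N≤n)) ⟩
    ½ ℚ.* ε ℚ.+ ½ ℚ.* ε                           ≡⟨ half+half ε ⟩
    ε                                             ∎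
    where
    open ℚₚ.≤-Reasoning
    open +-*-Solver
    eq : ∀ a b c d → (a ℚ.+ b) ℚ.- (c ℚ.+ d) ≡ (a ℚ.- c) ℚ.+ (b ℚ.- d)
    eq = solve 4 (λ a b c d → (a :+ b) :+ :- (c :+ d) := (a :+ :- c) :+ (b :+ :- d)) refl

  neg-cauchy : ∀ {x} → Cauchy x → Cauchy (λ n → ℚ.- x n)
  neg-cauchy {x} cx ε 0<ε with cx ε 0<ε
  ... | N , h = N , λ m n N≤m N≤n →
    subst (ℚ._< ε) (trans (∣p-q∣≡∣q-p∣ (x m) (x n)) (cong ℚ.∣_∣ (eq (x m) (x n)))) (h m n N≤m N≤n)
    where
    open +-*-Solver
    eq : ∀ a b → b ℚ.- a ≡ (ℚ.- a) ℚ.- (ℚ.- b)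
    eq = solve 2 (λ a b → b :+ :- a := (:- a) :+ :- (:- b)) refl

  abs-cauchy : ∀ {x} → Cauchy x → Cauchy (λ n → ℚ.∣ x n ∣)
  abs-cauchy {x} cx ε 0<ε with cx ε 0<ε
  ... | N , h = N , λ m n N≤m N≤n →
    ℚₚ.≤-<-trans (∣∣p∣-∣q∣∣≤∣p-q∣ (x m) (x n)) (h m n N≤m N≤n)

  const-cauchy : ∀ q → Cauchy (λ _ → q)
  const-cauchy q ε 0<ε = 0 , λ _ _ _ _ →
    subst (ℚ._< ε) (cong ℚ.∣_∣ (sym (ℚₚ.+-inverseʳ q))) 0<ε

  -- a positive upper bound for |x n|, valid from some index on
  tail-bound : ∀ {x} → Cauchy x →
    ∃[ B ] ∃[ N ] (0ℚ ℚ.< B × (∀ n → N ℕ.≤ n → ℚ.∣ x n ∣ ℚ.≤ B))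
  tail-bound {x} cx with cx 1ℚ (ℚₚ.positive⁻¹ 1ℚ)
  ... | N , h = ℚ.∣ x N ∣ ℚ.+ 1ℚ , N
    , ℚₚ.+-mono-≤-< (ℚₚ.0≤∣p∣ (x N)) (ℚₚ.positive⁻¹ 1ℚ)
    , λ n N≤n → begin
        ℚ.∣ x n ∣                               ≡⟨ cong ℚ.∣_∣ (eq (x n) (x N)) ⟩
        ℚ.∣ x N ℚ.+ (x n ℚ.- x N) ∣             ≤⟨ ℚₚ.∣p+q∣≤∣p∣+∣q∣ (x N) (x n ℚ.- x N) ⟩
        ℚ.∣ x N ∣ ℚ.+ ℚ.∣ x n ℚ.- x N ∣         ≤⟨ ℚₚ.+-monoʳ-≤ ℚ.∣ x N ∣ (ℚₚ.<⇒≤ (h n N N≤n ℕₚ.≤-refl)) ⟩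
        ℚ.∣ x N ∣ ℚ.+ 1ℚ                        ∎
    where
    open ℚₚ.≤-Reasoning
    open +-*-Solver
    eq : ∀ a b → a ≡ b ℚ.+ (a ℚ.- b)
    eq = solve 2 (λ a b → a := b :+ (a :+ :- b)) refl

  divide : ∀ B ε → 0ℚ ℚ.< B → 0ℚ ℚ.< ε → ∃[ δ ] (0ℚ ℚ.< δ × B ℚ.* δ ≡ ε)
  divide B ε 0<B 0<ε = B⁻¹ ℚ.* ε
    , subst (ℚ._< B⁻¹ ℚ.* ε) (ℚₚ.*-zeroʳ B⁻¹) (ℚₚ.*-monoʳ-<-pos B⁻¹ 0<ε)
    , trans (sym (ℚₚ.*-assoc B B⁻¹ ε)) (trans (cong (ℚ._* ε) (ℚₚ.*-inverseʳ B)) (ℚₚ.*-identityˡ ε))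
    where
    instance
      B-pos : ℚ.Positive B
      B-pos = ℚ.positive 0<B
      B-nonZero : ℚ.NonZero B
      B-nonZero = ℚₚ.pos⇒nonZero B
    B⁻¹ : ℚ
    B⁻¹ = ℚ.1/ B
    instance
      B⁻¹-pos : ℚ.Positive B⁻¹
      B⁻¹-pos = ℚₚ.1/pos⇒pos B

  *-close : ∀ B C δ a b c d → 0ℚ ℚ.< B → 0ℚ ℚ.< C → ℚ.∣ a ∣ ℚ.≤ B → ℚ.∣ d ∣ ℚ.≤ C →
    ℚ.∣ a ℚ.- c ∣ ℚ.< δ → ℚ.∣ b ℚ.- d ∣ ℚ.< δ → ℚ.∣ a ℚ.* b ℚ.- c ℚ.* d ∣ ℚ.< (B ℚ.+ C) ℚ.* δ
  *-close B C δ a b c d 0<B 0<C a≤B d≤C a-c<δ b-d<δ = begin-strict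
    ℚ.∣ a ℚ.* b ℚ.- c ℚ.* d ∣
      ≡⟨ cong ℚ.∣_∣ (eq a b c d) ⟩
    ℚ.∣ a ℚ.* (b ℚ.- d) ℚ.+ d ℚ.* (a ℚ.- c) ∣
      ≤⟨ ℚₚ.∣p+q∣≤∣p∣+∣q∣ (a ℚ.* (b ℚ.- d)) (d ℚ.* (a ℚ.- c)) ⟩
    ℚ.∣ a ℚ.* (b ℚ.- d) ∣ ℚ.+ ℚ.∣ d ℚ.* (a ℚ.- c) ∣
      <⟨ ℚₚ.+-mono-< (prod B a (b ℚ.- d) 0<B a≤B b-d<δ) (prod C d (a ℚ.- c) 0<C d≤C a-c<δ) ⟩
    B ℚ.* δ ℚ.+ C ℚ.* δ
      ≡⟨ sym (ℚₚ.*-distribʳ-+ δ B C) ⟩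
    (B ℚ.+ C) ℚ.* δ ∎
    where
    open ℚₚ.≤-Reasoning
    open +-*-Solver
    eq : ∀ a b c d → a ℚ.* b ℚ.- c ℚ.* d ≡ a ℚ.* (b ℚ.- d) ℚ.+ d ℚ.* (a ℚ.- c)
    eq = solve 4 (λ a b c d → a :* b :+ :- (c :* d) := a :* (b :+ :- d) :+ d :* (a :+ :- c)) refl
    prod : ∀ B p q → 0ℚ ℚ.< B → ℚ.∣ p ∣ ℚ.≤ B → ℚ.∣ q ∣ ℚ.< δ → ℚ.∣ p ℚ.* q ∣ ℚ.< B ℚ.* δ
    prod B p q 0<B p≤B q<δ = begin-strict
      ℚ.∣ p ℚ.* q ∣            ≡⟨ ℚₚ.∣p*q∣≡∣p∣*∣q∣ p q ⟩
      ℚ.∣ p ∣ ℚ.* ℚ.∣ q ∣      ≤⟨ ℚₚ.*-monoʳ-≤-nonNeg ℚ.∣ q ∣ {{ℚₚ.∣-∣-nonNeg q}} p≤B ⟩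
      B ℚ.* ℚ.∣ q ∣            <⟨ ℚₚ.*-monoʳ-<-pos B {{ℚ.positive 0<B}} q<δ ⟩
      B ℚ.* δ                  ∎

  *-cauchy : ∀ {x y} → Cauchy x → Cauchy y → Cauchy (λ n → x n ℚ.* y n)
  *-cauchy {x} {y} cx cy ε 0<ε =
    let B , K , 0<B , bx  = tail-bound {x} cx
        C , L , 0<C , by  = tail-bound {y} cy
        δ , 0<δ , [B+C]δ≡ε = divide (B ℚ.+ C) ε (ℚₚ.+-mono-< 0<B 0<C) 0<ε
        N₁ , h₁ = cx δ 0<δ
        N₂ , h₂ = cy δ 0<δ
        M = K ℕ.⊔ L
        N = N₁ ℕ.⊔ N₂
    in M ℕ.⊔ N , λ m n N≤m N≤n →
      let M≤m = ℕₚ.m⊔n≤o⇒m≤o M N N≤m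
          M≤n = ℕₚ.m⊔n≤o⇒m≤o M N N≤n
          N′≤m = ℕₚ.m⊔n≤o⇒n≤o M N N≤m
          N′≤n = ℕₚ.m⊔n≤o⇒n≤o M N N≤n
      in subst (ℚ.∣ x m ℚ.* y m ℚ.- x n ℚ.* y n ∣ ℚ.<_) [B+C]δ≡ε
           (*-close B C δ (x m) (y m) (x n) (y n) 0<B 0<C
             (bx m (ℕₚ.m⊔n≤o⇒m≤o K L M≤m)) (by n (ℕₚ.m⊔n≤o⇒n≤o K L M≤n))
             (h₁ m n (ℕₚ.m⊔n≤o⇒m≤o N₁ N₂ N′≤m) (ℕₚ.m⊔n≤o⇒m≤o N₁ N₂ N′≤n))
             (h₂ m n (ℕₚ.m⊔n≤o⇒n≤o N₁ N₂ N′≤m) (ℕₚ.m⊔n≤o⇒n≤o N₁ N₂ N′≤n)))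

infixl 6 _+ℝ_
infixl 7 _*ℝ_
infix  8 -ℝ_

fromℚ : ℚ → ℝ
fromℚ q = mkℝ (λ _ → q) (const-cauchy q)

fromℕℝ : ℕ → ℝ
fromℕℝ n = fromℚ (ℤ.+ n ℚ./ 1)

0ℝ 1ℝ : ℝ
0ℝ = fromℚ 0ℚ
1ℝ = fromℚ 1ℚ

_+ℝ_ _*ℝ_ : ℝ → ℝ → ℝ
x +ℝ y = mkℝ (λ n → seq x n ℚ.+ seq y n) (+-cauchy {seq x} {seq y} (cauchy x) (cauchy y))
x *ℝ y = mkℝ (λ n → seq x n ℚ.* seq y n) (*-cauchy {seq x} {seq y} (cauchy x) (cauchy y))

-ℝ_ ∣_∣ℝ : ℝ → ℝ
-ℝ x   = mkℝ (λ n → ℚ.- seq x n) (neg-cauchy {seq x} (cauchy x))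
∣ x ∣ℝ = mkℝ (λ n → ℚ.∣ seq x n ∣) (abs-cauchy {seq x} (cauchy x))

ℝ-rawRing : RawRing 0ℓ 0ℓ
ℝ-rawRing = record
  { Carrier = ℝ ; _≈_ = _≈ℝ_
  ; _+_ = _+ℝ_ ; _*_ = _*ℝ_ ; -_ = -ℝ_ ; 0# = 0ℝ ; 1# = 1ℝ }

∑ℝ : ∀ {n} → Vector ℝ n → ℝ
∑ℝ = RawMonoidDefs.sum (RawRing.+-rawMonoid ℝ-rawRing)

record ℂ : Set where
  constructor _+i_
  field
    re im : ℝ

open ℂ public

ℂ-rawRing : RawRing 0ℓ 0ℓ
ℂ-rawRing = record
  { Carrier = ℂ
  ; _≈_ = λ z w → (re z ≈ℝ re w) × (im z ≈ℝ im w)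
  ; _+_ = λ z w → (re z +ℝ re w) +i (im z +ℝ im w)
  ; _*_ = λ z w → (re z *ℝ re w +ℝ -ℝ (im z *ℝ im w)) +i (re z *ℝ im w +ℝ im z *ℝ re w)
  ; -_  = λ z → (-ℝ re z) +i (-ℝ im z)
  ; 0#  = 0ℝ +i 0ℝ
  ; 1#  = 1ℝ +i 0ℝ }

------------------------------------------------------------------------
-- Determinants (Laplace expansion along the first row) and
-- characteristic polynomials

module LinearAlgebra {c ℓ} (R : RawRing c ℓ) where
  open RawRing R
  open RawMonoidDefs +-rawMonoid using (sum)
  open RawSemiringDefs rawSemiring using (_^_)

  Matrix : ℕ → Set c
  Matrix n = Fin n → Fin n → Carrier

  det : ∀ {n} → Matrix n → Carrier
  det {zero}  A = 1#
  det {suc n} A =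
    sum λ j → (- 1#) ^ toℕ j * (A zero j * det (λ i k → A (suc i) (punchIn j k)))

  charPoly : ∀ {n} → Matrix n → Carrier → Carrier
  charPoly A x = det λ i j → (if ⌊ i ≟ᶠ j ⌋ then x else 0#) + - A i j

  -- zs lists the eigenvalues of A with their algebraic multiplicities:
  -- det (xI - A) = ∏ⱼ (x - zⱼ).  It is applied with R = ℂ, which is
  -- infinite, so polynomials can be compared as functions.
  IsSpectrum : ∀ {n} → Matrix n → Vector Carrier n → Set (c ⊔ ℓ)
  IsSpectrum A zs = ∀ x → charPoly A x ≈ product (λ j → x + - zs j)
    where open RawSemiringDefs rawSemiring using (product)

open LinearAlgebra ℂ-rawRing using (Matrix; IsSpectrum) public

------------------------------------------------------------------------
-- Signed digraphs on n vertices

-- nothing: no arc;  just s: an arc of sign s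
Sidigraph : ℕ → Set
Sidigraph n = Fin n → Fin n → Maybe Sign

order : ∀ {n} → Sidigraph n → ℕ
order {n} _ = n

signℂ : Sign → ℂ
signℂ Sign.+ = RawRing.1# ℂ-rawRing
signℂ Sign.- = RawRing.-_ ℂ-rawRing (RawRing.1# ℂ-rawRing)

adjacency : ∀ {n} → Sidigraph n → Matrix n
adjacency S i j = maybe′ signℂ (RawRing.0# ℂ-rawRing) (S i j)

-- The spectrum is unique up to reordering, so this is the graph of the
-- function S ↦ E(S).
HasEnergy : ∀ {n} → Sidigraph n → ℝ → Set
HasEnergy {n} S e =
  Σ[ zs ∈ Vector ℂ n ] (IsSpectrum (adjacency S) zs × (∑ℝ (λ j → ∣ re (zs j) ∣ℝ) ≈ℝ e))

-- Spectra are multisets, and IsSpectrum is insensitive to reordering: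
-- equal spectra means a common enumeration.
Cospectral : ∀ {n} → Sidigraph n → Sidigraph n → Set
Cospectral {n} S T =
  Σ[ zs ∈ Vector ℂ n ] (IsSpectrum (adjacency S) zs × IsSpectrum (adjacency T) zs)

Isomorphic : ∀ {n} → Sidigraph n → Sidigraph n → Set
Isomorphic {n} S T =
  Σ[ f ∈ Fin n ↔ Fin n ] (∀ u v → T (Inverse.to f u) (Inverse.to f v) ≡ S u v)

Equienergetic : ∀ {n} → Sidigraph n → Sidigraph n → Set
Equienergetic S T = ¬ Isomorphic S T × (∃[ e ] (HasEnergy S e × HasEnergy T e))

-- The two alternatives below overlap only when both factors have a loop.
infixr 7 _□_
_□_ : ∀ {m n} → Sidigraph m → Sidigraph n → Sidigraph (m ℕ.* n)
_□_ {m} {n} S T a b with remQuot {m} n a | remQuot {m} n b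
... | u , v | u′ , v′ =
  (if ⌊ v ≟ᶠ v′ ⌋ then S u u′ else nothing) <∣> (if ⌊ u ≟ᶠ u′ ⌋ then T v v′ else nothing)

K₂ : Sidigraph 2
K₂ u v = if ⌊ u ≟ᶠ v ⌋ then nothing else just Sign.+

-- In path and cycle, τ i is the sign of the arc leaving vertex i.  The last
-- vertex of a path has no outgoing arc, so its τ is not used.
path : ∀ {m} → Vector Sign m → Sidigraph m
path τ i j = if ⌊ toℕ j ℕₚ.≟ suc (toℕ i) ⌋ then just (τ i) else nothing

cycle : ∀ {l} .{{_ : ℕ.NonZero l}} → Vector Sign l → Sidigraph l
cycle {l} τ i j = if ⌊ toℕ j ℕₚ.≟ suc (toℕ i) ℕ.% l ⌋ then just (τ i) else nothing

Negative : ∀ {l} → Vector Sign l → Set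
Negative τ = Vector.foldr Sign._*_ Sign.+ τ ≡ Sign.-

-- Disjoint union of S and T with vertex v of S identified with vertex w of T.
-- The first m vertices are those of S other than v, the remaining n are
-- those of T.
identify : ∀ {m n} → Sidigraph (suc m) → Fin (suc m) → Sidigraph n → Fin n → Sidigraph (m ℕ.+ n)
identify {m} {n} S v T w a b = arc S (inS a) (inS b) <∣> arc T (inT a) (inT b)
  where
  -- the vertex of S (respectively T), if any, that a vertex comes from
  inS : Fin (m ℕ.+ n) → Maybe (Fin (suc m))
  inS a with splitAt m a
  ... | inj₁ i = just (punchIn v i)
  ... | inj₂ j = if ⌊ j ≟ᶠ w ⌋ then just v else nothing

  inT : Fin (m ℕ.+ n) → Maybe (Fin n)
  inT a with splitAt m a
  ... | inj₁ i = nothing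
  ... | inj₂ j = just j

  arc : ∀ {k} → Sidigraph k → Maybe (Fin k) → Maybe (Fin k) → Maybe Sign
  arc G (just i) (just j) = G i j
  arc G _        _        = nothing

IsEnd : ∀ {m} → Fin (suc m) → Set
IsEnd {m} v = (v ≡ zero) ⊎ (v ≡ fromℕ m)

-- PathCycle l {n} S: S is (a labelled copy of) Pₙˡ.  Here n = suc k + l, so
-- n ≥ l + 1 and the path has n - l + 1 = suc (suc k) vertices.
data PathCycle (l : ℕ) .{{_ : ℕ.NonZero l}} : ∀ {n} → Sidigraph n → Set where
  glue : ∀ {k} (τ : Vector Sign (suc (suc k))) (v : Fin (suc (suc k))) → IsEnd v →
         (ρ : Vector Sign l) → Negative ρ → (w : Fin l) →
         PathCycle l (identify (path τ) v (cycle ρ) w)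

module Submission where

-- The characteristic matrix of S □ K₂ is block triangular with respect to the
-- path vertices and the cycle.  The path contributes a factor (x - 1)(x + 1) per
-- vertex, and the negative cycle on l vertices contributes
-- ((x - 1)ˡ + 1)((x + 1)ˡ + 1): the eigenvalues of S □ K₂ are λ ± 1, where λ is 0
-- (once per path vertex) or an l-th root of -1.  Since |Re λ| ≤ 1, each pair
-- contributes |Re λ + 1| + |Re λ - 1| = 2 to the energy, which is therefore 2n.
-- At x = 0 the characteristic polynomial vanishes for l = 3 (λ = -1) but equals ±4 for l = 4, and
-- S □ K₂ has a directed triangle for l = 3 but is bipartite for l = 4.

open import Defs hiding (Matrix; IsSpectrum)
open import Algebra.Bundles using (CommutativeRing; Monoid)
open import Algebra.Bundles.Raw using (RawRing)
import Algebra.Definitions.RawMonoid as RawMonoidDefs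
import Algebra.Definitions.RawSemiring as RawSemiringDefs
import Algebra.Properties.AbelianGroup
import Algebra.Properties.Ring
import Algebra.Properties.Semiring.Mult.TCOptimised
import Algebra.Solver.Ring
open import Algebra.Solver.Ring.AlmostCommutativeRing
  using (AlmostCommutativeRing; fromCommutativeRing; _-Raw-AlmostCommutative⟶_)
open import Algebra.Structures using (IsCommutativeRing)
open import Data.Bool.Base using (Bool; true; false; not; _xor_; if_then_else_)
import Data.Bool.Properties as Boolₚ
open import Data.Fin.Base as Fin
  using (Fin; zero; suc; toℕ; punchIn; splitAt; _↑ˡ_; _↑ʳ_; cast; combine; remQuot)
open import Data.Fin.Properties as Finₚ using () renaming (_≟_ to _≟ᶠ_)
open import Data.Integer.Base as ℤ using (ℤ; +_; -[1+_]; +[1+_])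
import Data.Integer.Properties as ℤₚ
open import Data.Maybe.Base using (Maybe; just; nothing; maybe′; _<∣>_; from-just)
open import Data.Nat.Base as ℕ using (ℕ; zero; suc; z≤n; s≤s)
open import Data.Nat.Coprimality as Coprimality using (1-coprimeTo)
import Data.Nat.Properties as ℕₚ
open import Data.Product.Base using (∃-syntax; _×_; _,_; proj₁; proj₂; map₁)
open import Data.Rational.Base as ℚ using (ℚ; mkℚ; 0ℚ; 1ℚ; ½)
import Data.Rational.Properties as ℚₚ
open import Data.Rational.Solver using (module +-*-Solver)
import Data.Rational.Unnormalised.Base as ℚᵘ
import Data.Rational.Unnormalised.Properties as ℚᵘₚ
open import Data.Sign.Base as Sign using (Sign)
open import Data.Sum.Base using (_⊎_; inj₁; inj₂; [_,_])
import Data.Vec.Base as Vec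
open import Data.Vec.Functional as Vector using (Vector; _++_; _∷_; [])
open import Function.Base using (_∘_)
open import Function.Bundles using (Inverse)
open import Level using (0ℓ; _⊔_)
open import Relation.Binary.Definitions using (WeaklyDecidable)
open import Relation.Binary.PropositionalEquality as ≡ using (_≡_; _≢_)
open import Relation.Nullary using (¬_; Dec; yes; no; contradiction)
open import Relation.Nullary.Decidable using (⌊_⌋; from-no)

-- Block triangular determinants

-- The main obstacle is that `det` is a Laplace expansion and that ℂ consists of pairs of Cauchy
-- sequences, whose equality is a statement about limits: a determinant of order 6 or 8 over ℂ
-- cannot be settled by evaluating it. The algebra is therefore done over an arbitrary commutative
-- ring, whose elements stay opaque, and the cycle determinants are computed over integer
-- polynomials and then evaluated in the ring. There the cycle roots are arbitrary elements subject
-- to one or two equations, such as ω(1 - ω) = 1, so analysis enters only through √¾ and √½, which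
-- make those equations solvable in ℂ. The square roots are built so that each term of the
-- approximating sequence already lies in [0,1]. The identity |q + 1| + |q - 1| = 2 then holds
-- exactly at every index, and the energy needs no estimate. Both triangular shapes occur, since the
-- path may be glued to the cycle at its start or at its finish.

toℕ-punchIn-≤ : ∀ {n} (j : Fin (suc n)) (k : Fin n) → toℕ (punchIn j k) ℕ.≤ suc (toℕ k)
toℕ-punchIn-≤ zero    k       = ℕₚ.≤-refl
toℕ-punchIn-≤ (suc j) zero    = z≤n
toℕ-punchIn-≤ (suc j) (suc k) = s≤s (toℕ-punchIn-≤ j k)

toℕ-punchIn-< : ∀ {n} (j : Fin (suc n)) (k : Fin n) → toℕ k ℕ.< toℕ j → toℕ (punchIn j k) ≡ toℕ k
toℕ-punchIn-< (suc j) zero    _         = ≡.refl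
toℕ-punchIn-< (suc j) (suc k) (s≤s k<j) = ≡.cong suc (toℕ-punchIn-< j k k<j)

punchIn-↑ˡ-↑ˡ : ∀ {p} q (j : Fin (suc p)) (k : Fin p) → punchIn (j ↑ˡ q) (k ↑ˡ q) ≡ punchIn j k ↑ˡ q
punchIn-↑ˡ-↑ˡ q zero    k       = ≡.refl
punchIn-↑ˡ-↑ˡ q (suc j) zero    = ≡.refl
punchIn-↑ˡ-↑ˡ q (suc j) (suc k) = ≡.cong suc (punchIn-↑ˡ-↑ˡ q j k)

punchIn-↑ˡ-↑ʳ : ∀ p {q} (j : Fin (suc p)) (k : Fin q) → punchIn (j ↑ˡ q) (p ↑ʳ k) ≡ suc p ↑ʳ k
punchIn-↑ˡ-↑ʳ p       zero    k = ≡.refl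
punchIn-↑ˡ-↑ʳ (suc p) (suc j) k = ≡.cong suc (punchIn-↑ˡ-↑ʳ p j k)

toℕ-punchIn-≥ : ∀ {n} (j : Fin (suc n)) (k : Fin n) → toℕ j ℕ.≤ toℕ k → toℕ (punchIn j k) ≡ suc (toℕ k)
toℕ-punchIn-≥ zero    k       _         = ≡.refl
toℕ-punchIn-≥ (suc j) (suc k) (s≤s j≤k) = ≡.cong suc (toℕ-punchIn-≥ j k j≤k)

module _ {c ℓ} (M : Monoid c ℓ) where
  open Monoid M
  open RawMonoidDefs rawMonoid using (sum)

  sum-↑ : ∀ p {q} (f : Fin (p ℕ.+ q) → Carrier) → sum f ≈ sum (f ∘ (_↑ˡ q)) ∙ sum (f ∘ (p ↑ʳ_))
  sum-↑ zero    f = sym (identityˡ _)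
  sum-↑ (suc p) f = trans (∙-congˡ (sum-↑ p (f ∘ suc))) (sym (assoc _ _ _))

module RingSum {c ℓ} (R : CommutativeRing c ℓ) where
  open CommutativeRing R hiding (zero)
  open import Algebra.Properties.Monoid.Sum +-monoid public
    using (sum; sum-cong-≋; sum-replicate-zero)
  open import Algebra.Properties.Semiring.Sum semiring public using (*-distribʳ-sum)

  sum-zero : ∀ {n} (f : Fin n → Carrier) → (∀ i → f i ≈ 0#) → sum f ≈ 0#
  sum-zero {n} f f≈0 = trans (sum-cong-≋ f≈0) (sum-replicate-zero n)

module Determinant {c ℓ} (R : CommutativeRing c ℓ) where
  open CommutativeRing R hiding (zero)
  open import Relation.Binary.Reasoning.Setoid setoid
  open RingSum R
  open RawSemiringDefs (RawRing.rawSemiring rawRing) using (_^_)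
  open LinearAlgebra rawRing using (Matrix; det)

  private
    cofactor : ∀ {n} → Matrix (suc n) → Fin (suc n) → Carrier
    cofactor A j = det λ i k → A (suc i) (punchIn j k)

    term : ∀ {n} → Matrix (suc n) → Fin (suc n) → Carrier
    term A j = (- 1#) ^ toℕ j * (A zero j * cofactor A j)

    term-zero : ∀ {s a d} → a ≈ 0# → s * (a * d) ≈ 0#
    term-zero a≈0 = trans (*-congˡ (trans (*-congʳ a≈0) (zeroˡ _))) (zeroʳ _)

    term-zero′ : ∀ {s a d} → d ≈ 0# → s * (a * d) ≈ 0#
    term-zero′ d≈0 = trans (*-congˡ (trans (*-congˡ d≈0) (zeroʳ _))) (zeroʳ _)

  det-cong : ∀ {n} {A B : Matrix n} → (∀ i j → A i j ≈ B i j) → det A ≈ det B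
  det-cong {zero}  A≈B = refl
  det-cong {suc n} {A} {B} A≈B = sum-cong-≋ {suc n} {term A} {term B} λ j →
    *-congˡ {(- 1#) ^ toℕ j} (*-cong (A≈B zero j) (det-cong λ i k → A≈B (suc i) (punchIn j k)))

  -- The zero block has n - p rows and p + 1 columns, n + 1 in all, which is too much for a nonzero
  -- term of the determinant. In the induction, deleting the first row keeps all rows of the block,
  -- and deleting any column costs it at most one column.
  det-zero-corner : ∀ {n} p (A : Matrix n) → p ℕ.< n →
    (∀ i j → p ℕ.≤ toℕ i → toℕ j ℕ.≤ p → A i j ≈ 0#) → det A ≈ 0#
  det-zero-corner {suc n} zero A _ A≈0 = sum-zero (term A) λ where
    zero            → term-zero (A≈0 zero zero z≤n z≤n)
    (suc j) → term-zero′ (det-zero-corner zero _ (ℕₚ.≤-<-trans z≤n (Finₚ.toℕ<n j))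
      λ where i zero _ _ → A≈0 (suc i) (punchIn (suc j) zero) z≤n z≤n)
  det-zero-corner {suc n} (suc p) A (s≤s p<n) A≈0 = sum-zero (term A) λ j →
    term-zero′ (det-zero-corner p _ p<n λ i k p≤i k≤p →
      A≈0 (suc i) (punchIn j k) (s≤s p≤i) (ℕₚ.≤-trans (toℕ-punchIn-≤ j k) (s≤s k≤p)))

  -- Both shapes are handled by the same expansion along the first row. Columns of the left block
  -- give the expansion of the first factor; columns of the right block give zero, because of the
  -- entry when the upper right block vanishes and because of the minor when the lower left one
  -- does.
  det-block : ∀ p {q} (A : Matrix (p ℕ.+ q)) →
    (∀ i j → p ℕ.≤ toℕ i → toℕ j ℕ.< p → A i j ≈ 0#) ⊎
    (∀ i j → toℕ i ℕ.< p → p ℕ.≤ toℕ j → A i j ≈ 0#) →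
    det A ≈ det (λ i j → A (i ↑ˡ q) (j ↑ˡ q)) * det (λ i j → A (p ↑ʳ i) (p ↑ʳ j))
  det-block zero        A _   = sym (*-identityˡ _)
  det-block (suc p) {q} A tri = begin
    det A
      ≈⟨ sum-↑ +-monoid (suc p) {q} (term A) ⟩
    sum (term A ∘ (_↑ˡ q)) +
    sum (term A ∘ (suc p ↑ʳ_))
      ≈⟨ +-cong (sum-cong-≋ {suc p} left) (sum-zero (term A ∘ (suc p ↑ʳ_)) (right tri)) ⟩
    sum (λ j → term P j * det Q) + 0#
      ≈⟨ +-identityʳ _ ⟩
    sum (λ j → term P j * det Q)
      ≈⟨ *-distribʳ-sum (det Q) (term P) ⟨
    det P * det Q ∎
    where
    P : Matrix (suc p)
    P i j = A (i ↑ˡ q) (j ↑ˡ q)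
    Q : Matrix q
    Q i j = A (suc p ↑ʳ i) (suc p ↑ʳ j)
    σ σ′ : Fin (suc p) → Carrier
    σ j = (- 1#) ^ toℕ (j ↑ˡ q)
    σ′ j = (- 1#) ^ toℕ j

    minor : Fin (suc p) → Matrix (p ℕ.+ q)
    minor j i k = A (suc i) (punchIn (j ↑ˡ q) k)

    j≤p : ∀ (j : Fin (suc p)) → toℕ (j ↑ˡ q) ℕ.≤ p
    j≤p j = ℕₚ.≤-trans (ℕₚ.≤-reflexive (Finₚ.toℕ-↑ˡ j q)) (ℕₚ.≤-pred (Finₚ.toℕ<n j))

    Tri : Set _
    Tri = (∀ i j → suc p ℕ.≤ toℕ i → toℕ j ℕ.< suc p → A i j ≈ 0#) ⊎
          (∀ i j → toℕ i ℕ.< suc p → suc p ℕ.≤ toℕ j → A i j ≈ 0#)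

    tri′ : Tri → ∀ j → (∀ i k → p ℕ.≤ toℕ i → toℕ k ℕ.< p → minor j i k ≈ 0#) ⊎
                 (∀ i k → toℕ i ℕ.< p → p ℕ.≤ toℕ k → minor j i k ≈ 0#)
    tri′ (inj₁ low) j = inj₁ λ i k p≤i k<p → low (suc i) (punchIn (j ↑ˡ q) k) (s≤s p≤i)
                       (ℕₚ.≤-<-trans (toℕ-punchIn-≤ (j ↑ˡ q) k) (s≤s k<p))
    tri′ (inj₂ upp) j = inj₂ λ i k i<p p≤k → upp (suc i) (punchIn (j ↑ˡ q) k) (s≤s i<p)
                       (ℕₚ.≤-trans (s≤s p≤k) (ℕₚ.≤-reflexive (≡.sym (toℕ-punchIn-≥ (j ↑ˡ q) k (ℕₚ.≤-trans (j≤p j) p≤k)))))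

    left : ∀ j → term A (j ↑ˡ q) ≈ term P j * det Q
    left j = begin
      σ j * (A zero (j ↑ˡ q) * det (minor j))
        ≈⟨ *-cong (reflexive (≡.cong ((- 1#) ^_) (Finₚ.toℕ-↑ˡ j q))) (*-congˡ (det-block p (minor j) (tri′ tri j))) ⟩
      σ′ j * (P zero j * (det (λ i k → minor j (i ↑ˡ q) (k ↑ˡ q)) * det (λ i k → minor j (p ↑ʳ i) (p ↑ʳ k))))
        ≈⟨ *-congˡ (*-congˡ (*-cong
             (det-cong λ i k → reflexive (≡.cong (A (suc (i ↑ˡ q))) (punchIn-↑ˡ-↑ˡ q j k)))
             (det-cong λ i k → reflexive (≡.cong (A (suc (p ↑ʳ i))) (punchIn-↑ˡ-↑ʳ p j k))))) ⟩
      σ′ j * (P zero j * (cofactor P j * det Q))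
        ≈⟨ *-congˡ (*-assoc _ _ _) ⟨
      σ′ j * (P zero j * cofactor P j * det Q)
        ≈⟨ *-assoc _ _ _ ⟨
      σ′ j * (P zero j * cofactor P j) * det Q ∎

    right : Tri → ∀ (j : Fin q) →
      term A (suc p ↑ʳ j) ≈ 0#
    right (inj₂ upp) j = term-zero (upp zero (suc p ↑ʳ j) (s≤s z≤n)
      (ℕₚ.≤-trans (ℕₚ.m≤m+n (suc p) (toℕ j)) (ℕₚ.≤-reflexive (≡.sym (Finₚ.toℕ-↑ʳ (suc p) j)))))
    -- The deleted column lies to the right, so the minor, of order p + q, keeps all p + 1 left
    -- columns, and these vanish in its last q rows.
    right (inj₁ low) j = term-zero′ (det-zero-corner p _
      (ℕₚ.m<m+n p (ℕₚ.≤-<-trans z≤n (Finₚ.toℕ<n j)))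
      λ i k p≤i k≤p → low (suc i) (punchIn (suc p ↑ʳ j) k) (s≤s p≤i)
        (s≤s (ℕₚ.≤-trans (ℕₚ.≤-reflexive (toℕ-punchIn-< (suc p ↑ʳ j) k
          (ℕₚ.≤-trans (s≤s k≤p) (ℕₚ.≤-trans (ℕₚ.m≤m+n (suc p) (toℕ j))
            (ℕₚ.≤-reflexive (≡.sym (Finₚ.toℕ-↑ʳ (suc p) j))))))) k≤p)))

-- Polynomials with integer coefficients

module IntegerCoefficients {c ℓ} (R : CommutativeRing c ℓ) where
  open CommutativeRing R hiding (zero)
  open import Relation.Binary.Reasoning.Setoid setoid
  open Algebra.Properties.Semiring.Mult.TCOptimised semiring using (1+×; ×-homo-+; ×1-homo-*) renaming (_×_ to _·_)
  open Algebra.Properties.Ring ring using (-‿distribˡ-*; -‿distribʳ-*; -0#≈0#; -‿involutive)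
  open Algebra.Properties.AbelianGroup +-abelianGroup using (⁻¹-∙-comm)

  -- With this version of multiples `1 · 1#` computes to `1#`, so that `con (+ 1)` in solver
  -- expressions denotes `1#` itself.
  fromℤ : ℤ → Carrier
  fromℤ (+ n)    = n · 1#
  fromℤ -[1+ n ] = - (suc n · 1#)

  private
    fromℤ-neg : ∀ i → fromℤ (ℤ.- i) ≈ - fromℤ i
    fromℤ-neg (+ zero)  = sym -0#≈0#
    fromℤ-neg (+ suc n) = refl
    fromℤ-neg -[1+ n ]  = sym (-‿involutive _)

    cancel-1# : ∀ a b → a - b ≈ (1# + a) - (1# + b)
    cancel-1# a b = sym (begin
      (1# + a) - (1# + b)        ≈⟨ +-congˡ (⁻¹-∙-comm 1# b) ⟨
      (1# + a) + (- 1# - b)      ≈⟨ +-congʳ (+-comm 1# a) ⟩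
      (a + 1#) + (- 1# - b)      ≈⟨ +-assoc a 1# _ ⟩
      a + (1# + (- 1# - b))      ≈⟨ +-congˡ (+-assoc 1# (- 1#) _) ⟨
      a + ((1# - 1#) - b)        ≈⟨ +-congˡ (+-congʳ (-‿inverseʳ 1#)) ⟩
      a + (0# - b)               ≈⟨ +-congˡ (+-identityˡ _) ⟩
      a - b                      ∎)

    fromℤ-⊖ : ∀ m n → fromℤ (m ℤ.⊖ n) ≈ m · 1# - n · 1#
    fromℤ-⊖ m       zero    = trans (sym (+-identityʳ _)) (+-congˡ (sym -0#≈0#))
    fromℤ-⊖ zero    (suc n) = sym (+-identityˡ _)
    fromℤ-⊖ (suc m) (suc n) = begin
      fromℤ (suc m ℤ.⊖ suc n)             ≡⟨ ≡.cong fromℤ (ℤₚ.[1+m]⊖[1+n]≡m⊖n m n) ⟩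
      fromℤ (m ℤ.⊖ n)                     ≈⟨ fromℤ-⊖ m n ⟩
      m · 1# - n · 1#                     ≈⟨ cancel-1# _ _ ⟩
      (1# + m · 1#) - (1# + n · 1#)       ≈⟨ +-cong (1+× m 1#) (-‿cong (1+× n 1#)) ⟨
      suc m · 1# - suc n · 1#             ∎

    fromℤ-+ : ∀ i j → fromℤ (i ℤ.+ j) ≈ fromℤ i + fromℤ j
    fromℤ-+ (+ m)    (+ n)    = ×-homo-+ 1# m n
    fromℤ-+ (+ m)    -[1+ n ] = fromℤ-⊖ m (suc n)
    fromℤ-+ -[1+ m ] (+ n)    = trans (fromℤ-⊖ n (suc m)) (+-comm _ _)
    fromℤ-+ -[1+ m ] -[1+ n ] = begin
      - (suc (suc (m ℕ.+ n)) · 1#)         ≡⟨ ≡.cong (λ k → - (k · 1#)) (ℕₚ.+-suc (suc m) n) ⟨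
      - ((suc m ℕ.+ suc n) · 1#)           ≈⟨ -‿cong (×-homo-+ 1# (suc m) (suc n)) ⟩
      - (suc m · 1# + suc n · 1#)          ≈⟨ ⁻¹-∙-comm _ _ ⟨
      - (suc m · 1#) - suc n · 1#          ∎

    fromℤ-+* : ∀ m j → fromℤ (+ m ℤ.* j) ≈ fromℤ (+ m) * fromℤ j
    fromℤ-+* m (+ n)    = begin
      fromℤ (+ m ℤ.* + n)        ≡⟨ ≡.cong fromℤ (ℤₚ.pos-* m n) ⟨
      (m ℕ.* n) · 1#             ≈⟨ ×1-homo-* m n ⟩
      (m · 1#) * (n · 1#)        ∎
    fromℤ-+* m -[1+ n ] = begin
      fromℤ (+ m ℤ.* -[1+ n ])         ≡⟨ ≡.cong fromℤ (ℤₚ.neg-distribʳ-* (+ m) (+ suc n)) ⟨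
      fromℤ (ℤ.- (+ m ℤ.* + suc n))    ≈⟨ fromℤ-neg (+ m ℤ.* + suc n) ⟩
      - fromℤ (+ m ℤ.* + suc n)        ≈⟨ -‿cong (fromℤ-+* m (+ suc n)) ⟩
      - ((m · 1#) * (suc n · 1#))      ≈⟨ -‿distribʳ-* _ _ ⟩
      (m · 1#) * - (suc n · 1#)        ∎

    fromℤ-* : ∀ i j → fromℤ (i ℤ.* j) ≈ fromℤ i * fromℤ j
    fromℤ-* (+ m)    j = fromℤ-+* m j
    fromℤ-* -[1+ m ] j = begin
      fromℤ (-[1+ m ] ℤ.* j)           ≡⟨ ≡.cong fromℤ (ℤₚ.neg-distribˡ-* (+ suc m) j) ⟨
      fromℤ (ℤ.- (+ suc m ℤ.* j))      ≈⟨ fromℤ-neg (+ suc m ℤ.* j) ⟩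
      - fromℤ (+ suc m ℤ.* j)          ≈⟨ -‿cong (fromℤ-+* (suc m) j) ⟩
      - ((suc m · 1#) * fromℤ j)       ≈⟨ -‿distribˡ-* _ _ ⟩
      - (suc m · 1#) * fromℤ j         ∎

  almostCommutativeRing : AlmostCommutativeRing c ℓ
  almostCommutativeRing = fromCommutativeRing R

  fromℤ-homomorphism : ℤ.+-*-rawRing -Raw-AlmostCommutative⟶ almostCommutativeRing
  fromℤ-homomorphism = record
    { ⟦_⟧    = fromℤ
    ; +-homo = fromℤ-+
    ; *-homo = fromℤ-*
    ; -‿homo = fromℤ-neg
    ; 0-homo = refl
    ; 1-homo = refl
    }

  -- Normalisation must recognise equal coefficients. Elements of `R`, for instance Cauchy
  -- sequences, cannot be compared by computation, so the integers that they come from are compared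
  -- instead.
  fromℤ-≟ : WeaklyDecidable (λ i j → fromℤ i ≈ fromℤ j)
  fromℤ-≟ i j with i ℤₚ.≟ j
  ... | yes i≡j = just (reflexive (≡.cong fromℤ i≡j))
  ... | no  _   = nothing

  module Solver = Algebra.Solver.Ring ℤ.+-*-rawRing almostCommutativeRing fromℤ-homomorphism fromℤ-≟

module IntegerPolynomials {c ℓ} (R : CommutativeRing c ℓ) where
  open CommutativeRing R hiding (zero; rawRing)
  open IntegerCoefficients R
  open Solver public using (HNF)
  open Solver hiding (HNF)
  open import Relation.Binary.Reasoning.Setoid setoid
  open RingSum R

  -- A raw ring is enough to instantiate `det`; the computed value acquires its meaning in `R`
  -- through `eval-det`.
  ℤ[X] : RawRing 0ℓ ℓ
  ℤ[X] = record
    { Carrier = HNF 1 ; _≈_ = _≈H_ ; _+_ = _+H_ ; _*_ = _*H_ ; -_ = -H_ ; 0# = 0H ; 1# = 1H }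

  X : HNF 1
  X = (∅ *x+ 1N) *x+ 0N

  eval : Carrier → HNF 1 → Carrier
  eval x p = ⟦ p ⟧H (x Vec.∷ Vec.[])

  private
    module P = RawRing ℤ[X]
    open RawSemiringDefs (RawRing.rawSemiring ℤ[X]) using () renaming (_^_ to _^ᴾ_; sum to sumᴾ)
    open RawSemiringDefs (RawRing.rawSemiring (CommutativeRing.rawRing R)) using (_^_)

  eval-X : ∀ x → eval x X ≈ x
  eval-X x = begin
    (0# * x + 1#) * x + 0#         ≈⟨ +-identityʳ _ ⟩
    (0# * x + 1#) * x              ≈⟨ *-congʳ (+-congʳ (zeroˡ x)) ⟩
    (0# + 1#) * x                  ≈⟨ *-congʳ (+-identityˡ 1#) ⟩
    1# * x                         ≈⟨ *-identityˡ x ⟩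
    x                              ∎

  eval-1 : ∀ x → eval x P.1# ≈ 1#
  eval-1 x = 1N-homo (x Vec.∷ Vec.[])

  eval-neg : ∀ x p → eval x (P.- p) ≈ - eval x p
  eval-neg x p = -H‿-homo p (x Vec.∷ Vec.[])

  module _ (x : Carrier) where
    private
      open LinearAlgebra ℤ[X] using () renaming (Matrix to Matrixᴾ; det to detᴾ)
      open LinearAlgebra (CommutativeRing.rawRing R) using (det)

      eval-^ : ∀ p n → eval x (p ^ᴾ n) ≈ eval x p ^ n
      eval-^ p zero    = eval-1 x
      eval-^ p (suc n) = trans (*H-homo p (p ^ᴾ n) (x Vec.∷ Vec.[])) (*-congˡ (eval-^ p n))

      eval-sum : ∀ {n} (f : Fin n → HNF 1) → eval x (sumᴾ f) ≈ sum (λ i → eval x (f i))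
      eval-sum {zero}  f = refl
      eval-sum {suc n} f = trans (+H-homo (f zero) (sumᴾ (λ i → f (suc i))) (x Vec.∷ Vec.[]))
        (+-congˡ (eval-sum (λ i → f (suc i))))

    -- Evaluation preserves sums, products and negation, and the Laplace expansion is built from
    -- these alone.
    eval-det : ∀ {n} (A : Matrixᴾ n) → eval x (detᴾ A) ≈ det (λ i j → eval x (A i j))
    eval-det {zero}  A = eval-1 x
    eval-det {suc n} A = trans (eval-sum {suc n} term) (sum-cong-≋ {suc n} eval-term)
      where
      minor : Fin (suc n) → Matrixᴾ n
      minor j i k = A (suc i) (punchIn j k)
      s term : Fin (suc n) → HNF 1
      s j = (P.- P.1#) ^ᴾ toℕ j
      term j = s j *H (A zero j *H detᴾ (minor j))
      eval-term : ∀ j → eval x (term j) ≈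
        (- 1#) ^ toℕ j * (eval x (A zero j) * det (λ i k → eval x (minor j i k)))
      eval-term j = trans (*H-homo (s j) _ (x Vec.∷ Vec.[])) (*-cong
        (trans (eval-^ (P.- P.1#) (toℕ j)) (^-cong (toℕ j) (trans (eval-neg x P.1#) (-‿cong (eval-1 x)))))
        (trans (*H-homo (A zero j) (detᴾ (minor j)) (x Vec.∷ Vec.[])) (*-congˡ (eval-det (minor j)))))
        where
        ^-cong : ∀ n {a b} → a ≈ b → a ^ n ≈ b ^ n
        ^-cong zero    a≈b = refl
        ^-cong (suc n) a≈b = *-cong a≈b (^-cong n a≈b)

-- Arcs of S □ K₂ and of a path glued to a cycle

⌊⌋-injective : ∀ {m n} (f : Fin m → Fin n) → (∀ i j → f i ≡ f j → i ≡ j) →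
  ∀ i j → ⌊ f i ≟ᶠ f j ⌋ ≡ ⌊ i ≟ᶠ j ⌋
⌊⌋-injective f inj i j with i ≟ᶠ j | f i ≟ᶠ f j
... | yes _     | yes _     = ≡.refl
... | no  _     | no  _     = ≡.refl
... | yes i≡j   | no  fi≢fj = contradiction (≡.cong f i≡j) fi≢fj
... | no  i≢j   | yes fi≡fj = contradiction (inj i j fi≡fj) i≢j

⌊⌋-false : ∀ {n} {i j : Fin n} → i ≢ j → ⌊ i ≟ᶠ j ⌋ ≡ false
⌊⌋-false {i = i} {j} i≢j with i ≟ᶠ j
... | yes i≡j = contradiction i≡j i≢j
... | no  _   = ≡.refl

if-nothing : ∀ {A : Set} b → (if b then nothing else nothing) ≡ nothing {A = A}
if-nothing true  = ≡.refl
if-nothing false = ≡.refl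

↑ˡ≢↑ʳ : ∀ {m n} (i : Fin m) (j : Fin n) → i ↑ˡ n ≢ m ↑ʳ j
↑ˡ≢↑ʳ {m} {n} i j eq with () ← ≡.trans (≡.sym (Finₚ.splitAt-↑ˡ m i n))
  (≡.trans (≡.cong (splitAt m) eq) (Finₚ.splitAt-↑ʳ m n j))

-- The product on decoded vertices, so that known values of `remQuot` can be substituted for the two
-- arguments.
arc□K₂ : ∀ {n} → Sidigraph n → Fin n × Fin 2 → Fin n × Fin 2 → Maybe Sign
arc□K₂ S (u , v) (u′ , v′) =
  (if ⌊ v ≟ᶠ v′ ⌋ then S u u′ else nothing) <∣> (if ⌊ u ≟ᶠ u′ ⌋ then K₂ v v′ else nothing)

□K₂-arc : ∀ {n} (S : Sidigraph n) a b → (S □ K₂) a b ≡ arc□K₂ S (remQuot 2 a) (remQuot 2 b)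
□K₂-arc S a b = ≡.refl

-- Identifies the diagonal blocks: `F` is the embedding of product vertices induced by `f`, and it
-- reflects arcs of both kinds because `f` is injective.
□-restrict : ∀ {m n} (S : Sidigraph n) (f : Fin m → Fin n) → (∀ i j → f i ≡ f j → i ≡ j) →
  (F : Fin (m ℕ.* 2) → Fin (n ℕ.* 2)) → (∀ i → remQuot 2 (F i) ≡ map₁ f (remQuot {m} 2 i)) →
  ∀ i j → (S □ K₂) (F i) (F j) ≡ ((λ u v → S (f u) (f v)) □ K₂) i j
□-restrict {m} {n} S f f-inj F F≡ i j = ≡.trans (□K₂-arc S (F i) (F j))
  (≡.trans (≡.cong₂ (arc□K₂ S) (F≡ i) (F≡ j)) (arc-restrict (remQuot {m} 2 i) (remQuot {m} 2 j)))
  where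
  arc-restrict : ∀ p q → arc□K₂ S (map₁ f p) (map₁ f q) ≡ arc□K₂ (λ u v → S (f u) (f v)) p q
  arc-restrict (u , v) (u′ , v′) rewrite ⌊⌋-injective f f-inj u u′ = ≡.refl

□-cong : ∀ {n} {S T : Sidigraph n} → (∀ u v → S u v ≡ T u v) → ∀ a b → (S □ K₂) a b ≡ (T □ K₂) a b
□-cong {n} {S} {T} S≡T a b = arc-cong (remQuot {n} 2 a) (remQuot {n} 2 b)
  where
  arc-cong : ∀ p q → arc□K₂ S p q ≡ arc□K₂ T p q
  arc-cong (u , _) (u′ , _) rewrite S≡T u u′ = ≡.refl

□-nothing : ∀ {n} (S : Sidigraph n) a b {p q} → remQuot 2 a ≡ p → remQuot 2 b ≡ q →
  proj₁ p ≢ proj₁ q → S (proj₁ p) (proj₁ q) ≡ nothing → (S □ K₂) a b ≡ nothing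
□-nothing S a b {p} {q} a≡ b≡ u≢v Suv = ≡.trans (□K₂-arc S a b) (≡.trans (≡.cong₂ (arc□K₂ S) a≡ b≡) arc≡)
  where
  arc≡ : arc□K₂ S p q ≡ nothing
  arc≡ rewrite Suv | ⌊⌋-false u≢v = ≡.cong (_<∣> nothing) (if-nothing ⌊ proj₂ p ≟ᶠ proj₂ q ⌋)

OneWay : ∀ m {l} → Sidigraph (m ℕ.+ l) → Set
OneWay m {l} S = (∀ i j → S (m ↑ʳ i) (j ↑ˡ l) ≡ nothing) ⊎ (∀ i j → S (i ↑ˡ l) (m ↑ʳ j) ≡ nothing)

module _ (m : ℕ) {l : ℕ} where
  -- The vertex (u , v) of the product has index 2u + v, so an initial block of vertices of `S` is
  -- an initial block of twice the size in the product. Only the type of the index has to be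
  -- changed.
  unblock : Fin (m ℕ.* 2 ℕ.+ l ℕ.* 2) → Fin ((m ℕ.+ l) ℕ.* 2)
  unblock = cast (≡.sym (ℕₚ.*-distribʳ-+ 2 m l))

  unblock-injective : ∀ i j → unblock i ≡ unblock j → i ≡ j
  unblock-injective i j eq = Finₚ.toℕ-injective
    (≡.trans (≡.sym (Finₚ.toℕ-cast _ i)) (≡.trans (≡.cong toℕ eq) (Finₚ.toℕ-cast _ j)))

remQuot-unblock-↑ˡ : ∀ m {l} i → remQuot 2 (unblock m {l} (i ↑ˡ (l ℕ.* 2))) ≡ map₁ (_↑ˡ l) (remQuot {m} 2 i)
remQuot-unblock-↑ˡ (suc m)     zero          = ≡.refl
remQuot-unblock-↑ˡ (suc m)     (suc zero)    = ≡.refl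
remQuot-unblock-↑ˡ (suc m) {l} (suc (suc i)) = ≡.cong (map₁ suc) (remQuot-unblock-↑ˡ m {l} i)

remQuot-unblock-↑ʳ : ∀ m {l} i → remQuot 2 (unblock m {l} (m ℕ.* 2 ↑ʳ i)) ≡ map₁ (m ↑ʳ_) (remQuot {l} 2 i)
remQuot-unblock-↑ʳ zero    {l} i = ≡.cong (remQuot {l} 2) (Finₚ.cast-is-id ≡.refl i)
remQuot-unblock-↑ʳ (suc m) {l} i = ≡.cong (map₁ suc) (remQuot-unblock-↑ʳ m {l} i)

<∣>-nothing : ∀ {A : Set} (x : Maybe A) → (x <∣> nothing) ≡ x
<∣>-nothing (just _) = ≡.refl
<∣>-nothing nothing  = ≡.refl

module Identify {m n} (S : Sidigraph (suc m)) (v : Fin (suc m)) (T : Sidigraph n) (w : Fin n) where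

  identify-↑ˡ-↑ˡ : ∀ i j → identify S v T w (i ↑ˡ n) (j ↑ˡ n) ≡ S (punchIn v i) (punchIn v j)
  identify-↑ˡ-↑ˡ i j rewrite Finₚ.splitAt-↑ˡ m i n | Finₚ.splitAt-↑ˡ m j n = <∣>-nothing _

  -- The two digraphs share a single vertex, so a loop of `S` there is all that `S` could add inside
  -- the block of `T`.
  identify-↑ʳ-↑ʳ : S v v ≡ nothing → ∀ i j → identify S v T w (m ↑ʳ i) (m ↑ʳ j) ≡ T i j
  identify-↑ʳ-↑ʳ Svv i j rewrite Finₚ.splitAt-↑ʳ m n i | Finₚ.splitAt-↑ʳ m n j with i ≟ᶠ w | j ≟ᶠ w
  ... | yes _ | yes _ rewrite Svv = ≡.refl
  ... | yes _ | no  _ = ≡.refl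
  ... | no  _ | _     = ≡.refl

  identify-↑ˡ-↑ʳ : (∀ i → S (punchIn v i) v ≡ nothing) → ∀ i j → identify S v T w (i ↑ˡ n) (m ↑ʳ j) ≡ nothing
  identify-↑ˡ-↑ʳ Siv i j rewrite Finₚ.splitAt-↑ˡ m i n | Finₚ.splitAt-↑ʳ m n j with j ≟ᶠ w
  ... | yes _ rewrite Siv i = ≡.refl
  ... | no  _ = ≡.refl

  identify-↑ʳ-↑ˡ : (∀ j → S v (punchIn v j) ≡ nothing) → ∀ i j → identify S v T w (m ↑ʳ i) (j ↑ˡ n) ≡ nothing
  identify-↑ʳ-↑ˡ Svj i j rewrite Finₚ.splitAt-↑ʳ m n i | Finₚ.splitAt-↑ˡ m j n with i ≟ᶠ w
  ... | yes _ rewrite Svj j = ≡.refl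
  ... | no  _ = ≡.refl

path-nothing : ∀ {m} (τ : Vector Sign m) i j → toℕ j ≢ suc (toℕ i) → path τ i j ≡ nothing
path-nothing τ i j j≢1+i with toℕ j ℕₚ.≟ suc (toℕ i)
... | yes j≡1+i = contradiction j≡1+i j≢1+i
... | no  _     = ≡.refl

path-acyclic : ∀ {m} (τ : Vector Sign m) i j → toℕ j ℕ.≤ toℕ i → path τ i j ≡ nothing
path-acyclic τ i j j≤i = path-nothing τ i j (ℕₚ.<⇒≢ (s≤s j≤i))

module _ {k n} (τ : Vector Sign (suc (suc k))) (v : Fin (suc (suc k))) (T : Sidigraph n) (w : Fin n) where
  open Identify (path τ) v T w

  identify-path-acyclic : ∀ i j → toℕ j ℕ.≤ toℕ i →
    identify (path τ) v T w (i ↑ˡ n) (j ↑ˡ n) ≡ nothing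
  identify-path-acyclic i j j≤i = ≡.trans (identify-↑ˡ-↑ˡ i j)
    (path-acyclic τ (punchIn v i) (punchIn v j) (Finₚ.punchIn-mono-≤ v j i j≤i))

  identify-path-↑ʳ : ∀ i j → identify (path τ) v T w (suc k ↑ʳ i) (suc k ↑ʳ j) ≡ T i j
  identify-path-↑ʳ = identify-↑ʳ-↑ʳ (path-acyclic τ v v ℕₚ.≤-refl)

  -- Arcs of the path raise the index: nothing enters its first vertex and nothing leaves its last
  -- one. Which block triangular shape arises depends on the end that is glued.
  identify-path-oneWay : IsEnd v → OneWay (suc k) (identify (path τ) v T w)
  identify-path-oneWay (inj₁ ≡.refl) = inj₂ (identify-↑ˡ-↑ʳ λ i → path-acyclic τ (suc i) v z≤n)
  identify-path-oneWay (inj₂ ≡.refl) = inj₁ (identify-↑ʳ-↑ˡ λ j → path-acyclic τ v (punchIn v j)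
    (ℕₚ.≤-trans (ℕₚ.≤-pred (Finₚ.toℕ<n (punchIn v j))) (ℕₚ.≤-reflexive (≡.sym (Finₚ.toℕ-fromℕ (suc k))))))

-- Triangles, proper 2-colourings and nonisomorphism

HasArc : ∀ {n} → Sidigraph n → Fin n → Fin n → Set
HasArc S u v = ∃[ s ] S u v ≡ just s

-- A closed walk of length 3, possibly with repeated vertices; a proper 2-colouring excludes every
-- closed walk of odd length.
Triangle : ∀ {n} → Sidigraph n → Set
Triangle S = ∃[ u ] ∃[ v ] ∃[ w ] (HasArc S u v × HasArc S v w × HasArc S w u)

Proper : ∀ {n} → Sidigraph n → (Fin n → Bool) → Set
Proper S colour = ∀ u v → HasArc S u v → colour v ≡ not (colour u)

proper⇒¬triangle : ∀ {n} {S : Sidigraph n} {colour} → Proper S colour → ¬ Triangle S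
proper⇒¬triangle {colour = c} proper (u , v , w , uv , vw , wu) = Boolₚ.not-¬ ≡.refl (begin
  c u                     ≡⟨ proper w u wu ⟩
  not (c w)               ≡⟨ ≡.cong not (proper v w vw) ⟩
  not (not (c v))         ≡⟨ Boolₚ.not-involutive (c v) ⟩
  c v                     ≡⟨ proper u v uv ⟩
  not (c u)               ∎)
  where open ≡.≡-Reasoning

isomorphic-triangle : ∀ {n} {S T : Sidigraph n} → Isomorphic S T → Triangle S → Triangle T
isomorphic-triangle {S = S} {T} (f , f-arc) (u , v , w , uv , vw , wu) =
  to u , to v , to w , image uv , image vw , image wu
  where
  open Inverse f using (to)
  image : ∀ {u v} → HasArc S u v → HasArc T (to u) (to v)
  image {u} {v} (s , eq) = s , ≡.trans (f-arc u v) eq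

□K₂-hasArc : ∀ {n} {S : Sidigraph n} {u v} → HasArc S u v → HasArc (S □ K₂) (combine u zero) (combine v zero)
□K₂-hasArc {n} {S} {u} {v} (s , Suv) = s , ≡.trans (□K₂-arc S (combine u zero) (combine v zero))
  (≡.trans (≡.cong₂ (arc□K₂ S) (Finₚ.remQuot-combine {n} {2} u zero) (Finₚ.remQuot-combine {n} {2} v zero))
           (≡.cong (_<∣> _) Suv))

□K₂-triangle : ∀ {n} {S : Sidigraph n} → Triangle S → Triangle (S □ K₂)
□K₂-triangle {S = S} (u , v , w , uv , vw , wu) =
  combine u zero , combine v zero , combine w zero , □K₂-hasArc {S = S} uv , □K₂-hasArc {S = S} vw , □K₂-hasArc {S = S} wu

<∣>-just : ∀ {A : Set} (x y : Maybe A) {z} → (x <∣> y) ≡ just z → x ≡ just z ⊎ y ≡ just z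
<∣>-just (just _) y eq = inj₁ eq
<∣>-just nothing  y eq = inj₂ eq

if-just : ∀ {P A : Set} (P? : Dec P) {x : Maybe A} {z} →
  (if ⌊ P? ⌋ then x else nothing) ≡ just z → P × x ≡ just z
if-just (yes p) eq = p , eq

not-xorˡ : ∀ {a b} c → b ≡ not a → b xor c ≡ not (a xor c)
not-xorˡ {true}  c     ≡.refl = ≡.sym (Boolₚ.not-involutive c)
not-xorˡ {false} c     ≡.refl = ≡.refl

not-xorʳ : ∀ {a b} c → b ≡ not a → c xor b ≡ not (c xor a)
not-xorʳ {a} {b} c eq = ≡.trans (Boolₚ.xor-comm c b) (≡.trans (not-xorˡ c eq) (≡.cong not (Boolₚ.xor-comm a c)))

oddℕ : ℕ → Bool
oddℕ zero    = false
oddℕ (suc n) = not (oddℕ n)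

odd : ∀ {n} → Fin n → Bool
odd i = oddℕ (toℕ i)

K₂-proper : Proper K₂ odd
K₂-proper zero       zero       (_ , ())
K₂-proper zero       (suc zero) _ = ≡.refl
K₂-proper (suc zero) zero       _ = ≡.refl
K₂-proper (suc zero) (suc zero) (_ , ())

-- An arc of the product moves exactly one coordinate along an arc of its factor, and so flips
-- exactly one argument of `xor`.
□K₂-proper : ∀ {n} {S : Sidigraph n} {colour} → Proper S colour →
  Proper (S □ K₂) (λ a → colour (proj₁ (remQuot {n} 2 a)) xor odd (proj₂ (remQuot {n} 2 a)))
□K₂-proper {n} {S} {colour} proper a b (s , eq) = go (remQuot {n} 2 a) (remQuot {n} 2 b) eq
  where
  go : ∀ p q → arc□K₂ S p q ≡ just s →
    colour (proj₁ q) xor odd (proj₂ q) ≡ not (colour (proj₁ p) xor odd (proj₂ p))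
  go (u , v) (u′ , v′) eq
    with <∣>-just (if ⌊ v ≟ᶠ v′ ⌋ then S u u′ else nothing) (if ⌊ u ≟ᶠ u′ ⌋ then K₂ v v′ else nothing) eq
  ... | inj₁ eqˡ with ≡.refl , Suu′ ← if-just (v ≟ᶠ v′) eqˡ = not-xorˡ (odd v) (proper u u′ (s , Suu′))
  ... | inj₂ eqʳ with ≡.refl , vv′ ← if-just (u ≟ᶠ u′) eqʳ = not-xorʳ (colour u) (K₂-proper v v′ (s , vv′))

module _ {m n} {S : Sidigraph (suc m)} {T : Sidigraph n} {c d} (v : Fin (suc m)) (w : Fin n)
         (S-proper : Proper S c) (T-proper : Proper T d) where

  -- Each colouring is shifted by its value at the glued vertex. Both then give that vertex the
  -- colour `false`, so they fit together.
  identify-colour : Fin (m ℕ.+ n) → Bool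
  identify-colour a = [ (λ i → c (punchIn v i) xor c v) , (λ j → d j xor d w) ] (splitAt m a)

  identify-proper : Proper (identify S v T w) identify-colour
  identify-proper a b (s , eq) = go a b s eq
    where
    go : ∀ a b s → identify S v T w a b ≡ just s → identify-colour b ≡ not (identify-colour a)
    go a b s with splitAt m a | splitAt m b
    ... | inj₁ i | inj₁ j = λ eq → not-xorˡ (c v) (S-proper _ _ (s , ≡.trans (≡.sym (<∣>-nothing _)) eq))
    ... | inj₁ i | inj₂ j with j ≟ᶠ w
    ...   | no _ = λ ()
    ...   | yes ≡.refl = λ eq → ≡.trans (Boolₚ.xor-same (d j)) (≡.trans (≡.sym (Boolₚ.xor-same (c v)))
              (not-xorˡ (c v) (S-proper _ _ (s , ≡.trans (≡.sym (<∣>-nothing _)) eq))))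
    go a b s | inj₂ i | inj₁ j with i ≟ᶠ w
    ...   | no _ = λ ()
    ...   | yes ≡.refl = λ eq → ≡.trans
              (not-xorˡ (c v) (S-proper _ _ (s , ≡.trans (≡.sym (<∣>-nothing _)) eq)))
              (≡.cong not (≡.trans (Boolₚ.xor-same (c v)) (≡.sym (Boolₚ.xor-same (d i)))))
    go a b s | inj₂ i | inj₂ j with i ≟ᶠ w | j ≟ᶠ w
    ...   | no _ | _ = λ eq → not-xorˡ (d w) (T-proper i j (s , eq))
    ...   | yes _ | no _ = λ eq → not-xorˡ (d w) (T-proper i j (s , eq))
    -- Both ends are the glued vertex, so the arc is a loop; one coming from `S` would have to
    -- change the colour of `v`.
    ...   | yes _ | yes _ = λ eq → [ (λ Svv → contradiction (S-proper v v (s , Svv)) (Boolₚ.not-¬ ≡.refl))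
                                   , (λ Tij → not-xorˡ (d w) (T-proper i j (s , Tij))) ] (<∣>-just (S v v) (T i j) eq)

path-proper : ∀ {m} (τ : Vector Sign m) → Proper (path τ) odd
path-proper τ i j (s , eq) with toℕ j ℕₚ.≟ suc (toℕ i)
... | yes j≡1+i = ≡.cong oddℕ j≡1+i

cycle⁴-proper : ∀ (ρ : Vector Sign 4) → Proper (cycle ρ) odd
cycle⁴-proper ρ i j (s , eq) with toℕ j ℕₚ.≟ suc (toℕ i) ℕ.% 4
... | yes j≡1+i = ≡.trans (≡.cong oddℕ j≡1+i) (wrap i)
  where
  wrap : ∀ (i : Fin 4) → oddℕ (suc (toℕ i) ℕ.% 4) ≡ not (oddℕ (toℕ i))
  wrap zero                   = ≡.refl
  wrap (suc zero)             = ≡.refl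
  wrap (suc (suc zero))       = ≡.refl
  wrap (suc (suc (suc zero))) = ≡.refl

cycle³-triangle : ∀ (ρ : Vector Sign 3) → Triangle (cycle ρ)
cycle³-triangle ρ = zero , suc zero , suc (suc zero) , (_ , ≡.refl) , (_ , ≡.refl) , (_ , ≡.refl)

pathCycle³-triangle : ∀ {n} {S : Sidigraph n} → PathCycle 3 S → Triangle S
pathCycle³-triangle (glue {k} τ v _ ρ _ w) =
  let i , j , l , ij , jl , li = cycle³-triangle ρ
  in suc k ↑ʳ i , suc k ↑ʳ j , suc k ↑ʳ l , lift ij , lift jl , lift li
  where
  lift : ∀ {i j} → HasArc (cycle ρ) i j → HasArc (identify (path τ) v (cycle ρ) w) (suc k ↑ʳ i) (suc k ↑ʳ j)
  lift {i} {j} (s , eq) = s , ≡.trans (identify-path-↑ʳ τ v (cycle ρ) w i j) eq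

pathCycle⁴-proper : ∀ {n} {T : Sidigraph n} → PathCycle 4 T → ∃[ colour ] Proper T colour
pathCycle⁴-proper (glue τ v _ ρ _ w) = _ , identify-proper v w (path-proper τ) (cycle⁴-proper ρ)

pathCycle³□K₂≇pathCycle⁴□K₂ : ∀ {n} {S T : Sidigraph n} → PathCycle 3 S → PathCycle 4 T →
  ¬ Isomorphic (S □ K₂) (T □ K₂)
pathCycle³□K₂≇pathCycle⁴□K₂ {S = S} {T} S-path T-path iso =
  proper⇒¬triangle {S = T □ K₂} (□K₂-proper {S = T} (proj₂ (pathCycle⁴-proper T-path)))
    (isomorphic-triangle {S = S □ K₂} {T □ K₂} iso (□K₂-triangle {S = S} (pathCycle³-triangle S-path)))

-- The spectrum of S □ K₂

module Spectrum {c ℓ} (R : CommutativeRing c ℓ) (σ : Sign → CommutativeRing.Carrier R)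
                (σ+ : CommutativeRing._≈_ R (σ Sign.+) (CommutativeRing.1# R))
                (σ- : CommutativeRing._≈_ R (σ Sign.-) (CommutativeRing.-_ R (CommutativeRing.1# R))) where
  open CommutativeRing R hiding (zero)
  open import Relation.Binary.Reasoning.Setoid setoid
  open Determinant R
  open IntegerCoefficients R using (module Solver)
  open RawSemiringDefs (RawRing.rawSemiring rawRing) using (product)
  open LinearAlgebra rawRing using (Matrix; det; charPoly; IsSpectrum)
  open import Algebra.Properties.CommutativeMonoid.Sum *-commutativeMonoid
    using () renaming (sum-cong-≋ to product-cong)

  -- At `σ = signℂ` this computes to `adjacency`, so the results below apply directly to
  -- `IsSpectrum (adjacency S)`.
  adj : ∀ {n} → Sidigraph n → Matrix n
  adj S i j = maybe′ σ 0# (S i j)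

  charMatrix : ∀ {n} → Matrix n → Carrier → Matrix n
  charMatrix A x i j = (if ⌊ i ≟ᶠ j ⌋ then x else 0#) + - A i j

  φ : ∀ {n} → Sidigraph n → Carrier → Carrier
  φ S = charPoly (adj (S □ K₂))

  φ-cong : ∀ {n} {S T : Sidigraph n} → (∀ u v → S u v ≡ T u v) → ∀ x → φ S x ≈ φ T x
  φ-cong S≡T x = det-cong λ i j →
    +-congˡ (-‿cong (reflexive (≡.cong (maybe′ σ 0#) (□-cong S≡T i j))))

  det-cast : ∀ {m n} (eq : m ≡ n) (A : Matrix n) → det A ≈ det (λ i j → A (cast eq i) (cast eq j))
  det-cast ≡.refl A = det-cong λ i j →
    reflexive (≡.sym (≡.cong₂ A (Finₚ.cast-is-id ≡.refl i) (Finₚ.cast-is-id ≡.refl j)))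

  -- An arc coming from `K₂` fixes the first coordinate and stays in a diagonal block. Between
  -- different blocks the product has only arcs of `S`, so it inherits the one-way structure.
  φ-block : ∀ m {l} (S : Sidigraph (m ℕ.+ l)) →
    OneWay m S →
    ∀ x → φ S x ≈ φ (λ i j → S (i ↑ˡ l) (j ↑ˡ l)) x * φ (λ i j → S (m ↑ʳ i) (m ↑ʳ j)) x
  φ-block m {l} S tri x = begin
    φ S x
      ≈⟨ det-cast (≡.sym (ℕₚ.*-distribʳ-+ 2 m l)) _ ⟩
    det M
      ≈⟨ det-block (m ℕ.* 2) M (tri′ tri) ⟩
    det (λ i j → M (i ↑ˡ l ℕ.* 2) (j ↑ˡ l ℕ.* 2)) * det (λ i j → M (m ℕ.* 2 ↑ʳ i) (m ℕ.* 2 ↑ʳ j))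
      ≈⟨ *-cong
           (det-cong (restrict (_↑ˡ l) (Finₚ.↑ˡ-injective l) (λ i → unblock m (i ↑ˡ l ℕ.* 2))
             (λ i j eq → Finₚ.↑ˡ-injective _ i j (unblock-injective m _ _ eq)) (remQuot-unblock-↑ˡ m)))
           (det-cong (restrict (m ↑ʳ_) (Finₚ.↑ʳ-injective m) (λ i → unblock m (m ℕ.* 2 ↑ʳ i))
             (λ i j eq → Finₚ.↑ʳ-injective (m ℕ.* 2) i j (unblock-injective m _ _ eq)) (remQuot-unblock-↑ʳ m))) ⟩
    φ (λ i j → S (i ↑ˡ l) (j ↑ˡ l)) x * φ (λ i j → S (m ↑ʳ i) (m ↑ʳ j)) x ∎
    where
    M : Matrix (m ℕ.* 2 ℕ.+ l ℕ.* 2)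
    M i j = charMatrix (adj (S □ K₂)) x (unblock m i) (unblock m j)

    restrict : ∀ {k} (f : Fin k → Fin (m ℕ.+ l)) → (∀ i j → f i ≡ f j → i ≡ j) →
      (F : Fin (k ℕ.* 2) → Fin ((m ℕ.+ l) ℕ.* 2)) → (∀ i j → F i ≡ F j → i ≡ j) →
      (∀ i → remQuot 2 (F i) ≡ map₁ f (remQuot {k} 2 i)) → ∀ i j →
      charMatrix (adj (S □ K₂)) x (F i) (F j) ≈ charMatrix (adj ((λ u v → S (f u) (f v)) □ K₂)) x i j
    restrict f f-inj F F-inj F≡ i j = reflexive (≡.cong₂ (λ b s → (if b then x else 0#) + - maybe′ σ 0# s)
      (⌊⌋-injective F F-inj i j) (□-restrict S f f-inj F F≡ i j))

    entry-zero : ∀ a b {p q} → remQuot 2 (unblock m {l} a) ≡ p → remQuot 2 (unblock m {l} b) ≡ q →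
      proj₁ p ≢ proj₁ q → S (proj₁ p) (proj₁ q) ≡ nothing → M a b ≈ 0#
    entry-zero a b a≡ b≡ u≢v Suv = begin
      M a b     ≡⟨ ≡.cong₂ (λ b s → (if b then x else 0#) + - maybe′ σ 0# s)
                     (⌊⌋-false λ eq → u≢v (≡.cong proj₁ (≡.trans (≡.sym a≡) (≡.trans (≡.cong (remQuot 2) eq) b≡))))
                     (□-nothing S (unblock m a) (unblock m b) a≡ b≡ u≢v Suv) ⟩
      0# - 0#   ≈⟨ -‿inverseʳ 0# ⟩
      0#        ∎

    low : (∀ i j → S (m ↑ʳ i) (j ↑ˡ l) ≡ nothing) → ∀ a b → m ℕ.* 2 ℕ.≤ toℕ a → toℕ b ℕ.< m ℕ.* 2 → M a b ≈ 0#
    low S≡ a b a≥ b< = ≡.subst₂ (λ a b → M a b ≈ 0#)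
      (Finₚ.splitAt⁻¹-↑ʳ (Finₚ.splitAt-≥ (m ℕ.* 2) a a≥)) (Finₚ.splitAt⁻¹-↑ˡ (Finₚ.splitAt-< (m ℕ.* 2) b b<))
      (entry-zero _ _ (remQuot-unblock-↑ʳ m (Fin.reduce≥ a a≥)) (remQuot-unblock-↑ˡ m (Fin.fromℕ< b<))
        (λ eq → ↑ˡ≢↑ʳ {m} {l} _ _ (≡.sym eq)) (S≡ _ _))

    upp : (∀ i j → S (i ↑ˡ l) (m ↑ʳ j) ≡ nothing) → ∀ a b → toℕ a ℕ.< m ℕ.* 2 → m ℕ.* 2 ℕ.≤ toℕ b → M a b ≈ 0#
    upp S≡ a b a< b≥ = ≡.subst₂ (λ a b → M a b ≈ 0#)
      (Finₚ.splitAt⁻¹-↑ˡ (Finₚ.splitAt-< (m ℕ.* 2) a a<)) (Finₚ.splitAt⁻¹-↑ʳ (Finₚ.splitAt-≥ (m ℕ.* 2) b b≥))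
      (entry-zero _ _ (remQuot-unblock-↑ˡ m (Fin.fromℕ< a<)) (remQuot-unblock-↑ʳ m (Fin.reduce≥ b b≥))
        (↑ˡ≢↑ʳ {m} {l} _ _) (S≡ _ _))

    tri′ : OneWay m S →
      (∀ a b → m ℕ.* 2 ℕ.≤ toℕ a → toℕ b ℕ.< m ℕ.* 2 → M a b ≈ 0#) ⊎
      (∀ a b → toℕ a ℕ.< m ℕ.* 2 → m ℕ.* 2 ℕ.≤ toℕ b → M a b ≈ 0#)
    tri′ (inj₁ S≡) = inj₁ (low S≡)
    tri′ (inj₂ S≡) = inj₂ (upp S≡)

  -- The quadratic factor that an eigenvalue z of `S` contributes to the characteristic polynomial
  -- of `S □ K₂`.
  pair : Carrier → Carrier → Carrier
  pair x z = (x - (z + 1#)) * (x - (z - 1#))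

  -- A record, so that comparing two instances compares the digraphs instead of
  -- unfolding determinants.
  record HasCharPoly {n} (S : Sidigraph n) (f : Carrier → Carrier) : Set (c ⊔ ℓ) where
    field φ≈ : ∀ x → φ S x ≈ f x

  open HasCharPoly public

  resp-≗ : ∀ {n} {S T : Sidigraph n} {f} → (∀ u v → S u v ≡ T u v) → HasCharPoly T f → HasCharPoly S f
  resp-≗ {S = S} {T} S≗T p .φ≈ x = trans (φ-cong {S = S} {T} S≗T x) (p .φ≈ x)

  resp-≈ : ∀ {n} {S : Sidigraph n} {f g} → (∀ x → f x ≈ g x) → HasCharPoly S f → HasCharPoly S g
  resp-≈ f≈g p .φ≈ x = trans (p .φ≈ x) (f≈g x)

  -- z lists the eigenvalues of S, through those of S □ K₂, which are z u ± 1.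
  Spectral : ∀ {n} → Sidigraph n → Vector Carrier n → Set (c ⊔ ℓ)
  Spectral {n} S z = HasCharPoly S (λ x → product {n} (λ u → pair x (z u)))

  -- The eigenvalues of `K₂`.
  ε : Fin 2 → Carrier
  ε zero       = 1#
  ε (suc zero) = - 1#

  eigenvalue : ∀ {n} → Vector Carrier n → Fin n × Fin 2 → Carrier
  eigenvalue z (u , v) = z u + ε v

  product-pairs : ∀ n (z : Vector Carrier n) x →
    product {n ℕ.* 2} (λ a → x - eigenvalue z (remQuot 2 a)) ≈ product {n} (λ u → pair x (z u))
  product-pairs zero    z x = refl
  product-pairs (suc n) z x = trans (sym (*-assoc _ _ _)) (*-congˡ (product-pairs n (z ∘ suc) x))

  spectral⇒isSpectrum : ∀ {n} {S : Sidigraph n} {z} → Spectral S z →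
    IsSpectrum (adj (S □ K₂)) (λ a → eigenvalue z (remQuot 2 a))
  spectral⇒isSpectrum {n} {S} {z} spec x = trans (spec .φ≈ x) (sym (product-pairs n z x))

  hasCharPoly-glue : ∀ m {l} (S : Sidigraph (m ℕ.+ l)) {f g} →
    OneWay m S →
    HasCharPoly (λ i j → S (i ↑ˡ l) (j ↑ˡ l)) f → HasCharPoly (λ i j → S (m ↑ʳ i) (m ↑ʳ j)) g →
    HasCharPoly S (λ x → f x * g x)
  hasCharPoly-glue m S tri p q .φ≈ x = trans (φ-block m S tri x) (*-cong (p .φ≈ x) (q .φ≈ x))

  product-++ : ∀ m {l} (z : Vector Carrier m) (w : Vector Carrier l) x →
    product {m} (λ u → pair x (z u)) * product {l} (λ u → pair x (w u)) ≈ product (λ u → pair x ((z ++ w) u))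
  product-++ m {l} z w x = begin
    product {m} (λ u → pair x (z u)) * product {l} (λ u → pair x (w u))
      ≈⟨ *-cong
           (product-cong {m} λ u → reflexive (≡.cong (pair x ∘ [ z , w ]) (≡.sym (Finₚ.splitAt-↑ˡ m u l))))
           (product-cong {l} λ u → reflexive (≡.cong (pair x ∘ [ z , w ]) (≡.sym (Finₚ.splitAt-↑ʳ m l u)))) ⟩
    product {m} (λ u → pair x ((z ++ w) (u ↑ˡ l))) * product {l} (λ u → pair x ((z ++ w) (m ↑ʳ u)))
      ≈⟨ sum-↑ *-monoid m (λ u → pair x ((z ++ w) u)) ⟨
    product (λ u → pair x ((z ++ w) u)) ∎

  spectral-isolated : Spectral {1} (λ _ _ → nothing) (λ _ → 0#)
  -- The first expression is the Laplace expansion of the 2 × 2 determinant.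
  spectral-isolated .φ≈ x = begin
    1# * ((x - 0#) * (1# * ((x - 0#) * 1#) + 0#)) +
      ((- 1# * 1#) * ((0# - σ Sign.+) * (1# * ((0# - σ Sign.+) * 1#) + 0#)) + 0#)
        ≈⟨ solve 2 (λ x s →
             con (+ 1) :* ((x :- con (+ 0)) :* (con (+ 1) :* ((x :- con (+ 0)) :* con (+ 1)) :+ con (+ 0))) :+
               ((:- con (+ 1) :* con (+ 1)) :* ((con (+ 0) :- s) :* (con (+ 1) :* ((con (+ 0) :- s) :* con (+ 1)) :+ con (+ 0))) :+ con (+ 0))
             := x :* x :- s :* s) refl x (σ Sign.+) ⟩
    x * x - σ Sign.+ * σ Sign.+
        ≈⟨ +-congˡ (-‿cong (*-cong σ+ σ+)) ⟩
    x * x - 1# * 1#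
        ≈⟨ solve 1 (λ x → x :* x :- con (+ 1) :* con (+ 1) :=
             (x :- (con (+ 0) :+ con (+ 1))) :* (x :- (con (+ 0) :- con (+ 1))) :* con (+ 1)) refl x ⟩
    pair x 0# * 1# ∎
    where open Solver

  -- The vertices are in topological order: vertex zero receives no arcs, so it splits off as an
  -- isolated vertex, and the rest is again of this form.
  spectral-acyclic : ∀ m (S : Sidigraph m) → (∀ i j → toℕ j ℕ.≤ toℕ i → S i j ≡ nothing) →
    Spectral S (λ _ → 0#)
  spectral-acyclic zero    S acyclic .φ≈ x = refl
  spectral-acyclic (suc m) S acyclic .φ≈ x = begin
    φ S x
      ≈⟨ φ-block 1 S (inj₁ λ { i zero → acyclic (suc i) zero z≤n }) x ⟩
    φ (λ i j → S (i ↑ˡ m) (j ↑ˡ m)) x * φ (λ i j → S (suc i) (suc j)) x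
      ≈⟨ *-cong (resp-≗ {S = λ i j → S (i ↑ˡ m) (j ↑ˡ m)} (λ { zero zero → acyclic zero zero z≤n }) spectral-isolated .φ≈ x)
                (spectral-acyclic m _ (λ i j j≤i → acyclic (suc i) (suc j) (s≤s j≤i)) .φ≈ x) ⟩
    (pair x 0# * 1#) * product {m} (λ _ → pair x 0#)
      ≈⟨ *-congʳ (*-identityʳ _) ⟩
    pair x 0# * product {m} (λ _ → pair x 0#) ∎

  -- In Horner form 0 is ∅ and absorbs products by computation, so the Laplace expansion
  -- of the sparse 6 × 6 and 8 × 8 matrices of the cycles can be evaluated.
  module Poly where
    open IntegerPolynomials R
    private module P = RawRing ℤ[X]

    σᴾ : Sign → HNF 1
    σᴾ Sign.+ = P.1#
    σᴾ Sign.- = P.- P.1#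

    entryᴾ : Bool → Maybe Sign → HNF 1
    entryᴾ b s = (if b then X else P.0#) P.+ P.- maybe′ σᴾ P.0# s

    φᴾ : ∀ {n} → Sidigraph n → HNF 1
    φᴾ S = LinearAlgebra.charPoly ℤ[X] (λ a b → maybe′ σᴾ P.0# ((S □ K₂) a b)) X

    eval-entry : ∀ x b s → eval x (entryᴾ b s) ≈ (if b then x else 0#) - maybe′ σ 0# s
    eval-entry x b s = trans (Solver.+H-homo (if b then X else P.0#) _ _)
      (+-cong (eval-if b) (trans (eval-neg x (maybe′ σᴾ P.0# s)) (-‿cong (eval-maybe s))))
      where
      eval-if : ∀ b → eval x (if b then X else P.0#) ≈ (if b then x else 0#)
      eval-if true  = eval-X x
      eval-if false = refl
      eval-maybe : ∀ s → eval x (maybe′ σᴾ P.0# s) ≈ maybe′ σ 0# s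
      eval-maybe nothing         = refl
      eval-maybe (just Sign.+)   = trans (eval-1 x) (sym σ+)
      eval-maybe (just Sign.-)   = trans (trans (eval-neg x P.1#) (-‿cong (eval-1 x))) (sym σ-)

    eval-φ : ∀ {n} (S : Sidigraph n) x → eval x (φᴾ S) ≈ φ S x
    eval-φ {n} S x = trans (eval-det x {n ℕ.* 2} (λ i j → entryᴾ ⌊ i ≟ᶠ j ⌋ ((S □ K₂) i j)))
      (det-cong {n ℕ.* 2} λ i j → eval-entry x ⌊ i ≟ᶠ j ⌋ ((S □ K₂) i j))

    open Solver using (Polynomial; normalise; poly; _:+_; _:*_; _:-_; _:^_; con; var; _≈N_; _≟N_)

    cycle³ᴾ cycle⁴ᴾ : Polynomial 1
    cycle³ᴾ = ((var zero :- con (+ 1)) :^ 3 :+ con (+ 1)) :* ((var zero :+ con (+ 1)) :^ 3 :+ con (+ 1))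
    cycle⁴ᴾ = ((var zero :- con (+ 1)) :^ 4 :+ con (+ 1)) :* ((var zero :+ con (+ 1)) :^ 4 :+ con (+ 1))

    -- The listed sign patterns are those with an odd number of minus signs; `Negative` refutes the
    -- others. All coefficients are integers, so `≟N` computes to `just` although `R` is abstract.
    φᴾ-cycle³ : ∀ a b c → Negative (a ∷ b ∷ c ∷ []) →
      poly (φᴾ (cycle (a ∷ b ∷ c ∷ []))) ≈N normalise cycle³ᴾ
    φᴾ-cycle³ Sign.+ Sign.+ Sign.- _ = from-just (poly (φᴾ (cycle (Sign.+ ∷ Sign.+ ∷ Sign.- ∷ []))) ≟N normalise cycle³ᴾ)
    φᴾ-cycle³ Sign.+ Sign.- Sign.+ _ = from-just (poly (φᴾ (cycle (Sign.+ ∷ Sign.- ∷ Sign.+ ∷ []))) ≟N normalise cycle³ᴾ)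
    φᴾ-cycle³ Sign.- Sign.+ Sign.+ _ = from-just (poly (φᴾ (cycle (Sign.- ∷ Sign.+ ∷ Sign.+ ∷ []))) ≟N normalise cycle³ᴾ)
    φᴾ-cycle³ Sign.- Sign.- Sign.- _ = from-just (poly (φᴾ (cycle (Sign.- ∷ Sign.- ∷ Sign.- ∷ []))) ≟N normalise cycle³ᴾ)

    φᴾ-cycle⁴ : ∀ a b c d → Negative (a ∷ b ∷ c ∷ d ∷ []) →
      poly (φᴾ (cycle (a ∷ b ∷ c ∷ d ∷ []))) ≈N normalise cycle⁴ᴾ
    φᴾ-cycle⁴ Sign.+ Sign.+ Sign.+ Sign.- _ =
      from-just (poly (φᴾ (cycle (Sign.+ ∷ Sign.+ ∷ Sign.+ ∷ Sign.- ∷ []))) ≟N normalise cycle⁴ᴾ)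
    φᴾ-cycle⁴ Sign.+ Sign.+ Sign.- Sign.+ _ =
      from-just (poly (φᴾ (cycle (Sign.+ ∷ Sign.+ ∷ Sign.- ∷ Sign.+ ∷ []))) ≟N normalise cycle⁴ᴾ)
    φᴾ-cycle⁴ Sign.+ Sign.- Sign.+ Sign.+ _ =
      from-just (poly (φᴾ (cycle (Sign.+ ∷ Sign.- ∷ Sign.+ ∷ Sign.+ ∷ []))) ≟N normalise cycle⁴ᴾ)
    φᴾ-cycle⁴ Sign.+ Sign.- Sign.- Sign.- _ =
      from-just (poly (φᴾ (cycle (Sign.+ ∷ Sign.- ∷ Sign.- ∷ Sign.- ∷ []))) ≟N normalise cycle⁴ᴾ)
    φᴾ-cycle⁴ Sign.- Sign.+ Sign.+ Sign.+ _ =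
      from-just (poly (φᴾ (cycle (Sign.- ∷ Sign.+ ∷ Sign.+ ∷ Sign.+ ∷ []))) ≟N normalise cycle⁴ᴾ)
    φᴾ-cycle⁴ Sign.- Sign.+ Sign.- Sign.- _ =
      from-just (poly (φᴾ (cycle (Sign.- ∷ Sign.+ ∷ Sign.- ∷ Sign.- ∷ []))) ≟N normalise cycle⁴ᴾ)
    φᴾ-cycle⁴ Sign.- Sign.- Sign.+ Sign.- _ =
      from-just (poly (φᴾ (cycle (Sign.- ∷ Sign.- ∷ Sign.+ ∷ Sign.- ∷ []))) ≟N normalise cycle⁴ᴾ)
    φᴾ-cycle⁴ Sign.- Sign.- Sign.- Sign.+ _ =
      from-just (poly (φᴾ (cycle (Sign.- ∷ Sign.- ∷ Sign.- ∷ Sign.+ ∷ []))) ≟N normalise cycle⁴ᴾ)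

    hasCharPoly : ∀ {n} (S : Sidigraph n) p → poly (φᴾ S) ≈N normalise p →
      HasCharPoly S (λ x → Solver.⟦ p ⟧ (x Vec.∷ Vec.[]))
    hasCharPoly S p eq .φ≈ x = trans (sym (eval-φ S x))
      (trans (Solver.⟦ eq ⟧N-cong (x Vec.∷ Vec.[])) (Solver.correct p (x Vec.∷ Vec.[])))

  module Roots where
    open Solver using (Polynomial; solve; _:+_; _:*_; _:-_; :-_; _:^_; _:=_; con)

    -- At p = 1 this is y³ + 1, and at p = ω(1 - ω) it is (y + 1)(y - ω)(y - (1 - ω)). Keeping p as
    -- a parameter makes both facts free polynomial identities, joined by one substitution of the
    -- equation for ω.
    quadratic : Carrier → Carrier → Carrier
    quadratic p y = (y + 1#) * (y * y - y + p)

    -- The cube roots of -1 are -1 and the roots ω, 1 - ω of y² - y + 1.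
    product-roots³ : ∀ x ω → ω * (1# - ω) ≈ 1# →
      product {3} (λ u → pair x ((- 1# ∷ ω ∷ 1# - ω ∷ []) u)) ≈ Solver.⟦ Poly.cycle³ᴾ ⟧ (x Vec.∷ Vec.[])
    product-roots³ x ω ω≈ = begin
      product {3} (λ u → pair x ((- 1# ∷ ω ∷ 1# - ω ∷ []) u))
        ≈⟨ solve 2 (λ x ω → pairᴾ x (:- con (+ 1)) :* (pairᴾ x ω :* (pairᴾ x (con (+ 1) :- ω) :* con (+ 1))) :=
             quadraticᴾ (ω :* (con (+ 1) :- ω)) (x :- con (+ 1)) :* quadraticᴾ (ω :* (con (+ 1) :- ω)) (x :+ con (+ 1)))
             refl x ω ⟩
      quadratic (ω * (1# - ω)) (x - 1#) * quadratic (ω * (1# - ω)) (x + 1#)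
        ≈⟨ *-cong (*-congˡ (+-congˡ ω≈)) (*-congˡ (+-congˡ ω≈)) ⟩
      quadratic 1# (x - 1#) * quadratic 1# (x + 1#)
        ≈⟨ solve 1 (λ x → quadraticᴾ (con (+ 1)) (x :- con (+ 1)) :* quadraticᴾ (con (+ 1)) (x :+ con (+ 1)) :=
             ((x :- con (+ 1)) :^ 3 :+ con (+ 1)) :* ((x :+ con (+ 1)) :^ 3 :+ con (+ 1))) refl x ⟩
      Solver.⟦ Poly.cycle³ᴾ ⟧ (x Vec.∷ Vec.[]) ∎
      where
      pairᴾ quadraticᴾ : ∀ {n} → Polynomial n → Polynomial n → Polynomial n
      pairᴾ x z = (x :- (z :+ con (+ 1))) :* (x :- (z :- con (+ 1)))
      quadraticᴾ p y = (y :+ con (+ 1)) :* (y :* y :- y :+ p)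

    -- Two differences of squares, the factors being grouped by x - 1 and x + 1; the right side
    -- depends on z only through its square.
    pair-± : ∀ x z → pair x z * pair x (- z) ≈
      ((x - 1#) * (x - 1#) - z * z) * ((x + 1#) * (x + 1#) - z * z)
    pair-± = solve 2 (λ x z →
      (x :- (z :+ con (+ 1))) :* (x :- (z :- con (+ 1))) :* ((x :- (:- z :+ con (+ 1))) :* (x :- (:- z :- con (+ 1)))) :=
      ((x :- con (+ 1)) :* (x :- con (+ 1)) :- z :* z) :* ((x :+ con (+ 1)) :* (x :+ con (+ 1)) :- z :* z)) refl

    -- ζ² and ξ² are the two square roots of -1, given by their sum and product.
    product-roots⁴ : ∀ x ζ ξ → ζ * ζ + ξ * ξ ≈ 0# → (ζ * ζ) * (ξ * ξ) ≈ 1# →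
      product {4} (λ u → pair x ((ζ ∷ - ζ ∷ ξ ∷ - ξ ∷ []) u)) ≈ Solver.⟦ Poly.cycle⁴ᴾ ⟧ (x Vec.∷ Vec.[])
    product-roots⁴ x ζ ξ s≈0 p≈1 = begin
      product {4} (λ u → pair x ((ζ ∷ - ζ ∷ ξ ∷ - ξ ∷ []) u))
        ≈⟨ solve 4 (λ a b c d → a :* (b :* (c :* (d :* con (+ 1)))) := (a :* b) :* (c :* d)) refl _ _ _ _ ⟩
      (pair x ζ * pair x (- ζ)) * (pair x ξ * pair x (- ξ))
        ≈⟨ *-cong (pair-± x ζ) (pair-± x ξ) ⟩
      ((a - q) * (b - q)) * ((a - r) * (b - r))
        -- Vieta: (a - q)(a - r) is written through the sum and the product of q and r, which are
        -- known to be 0 and 1; what remains is a² + 1, a fourth power plus one.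
        ≈⟨ solve 4 (λ a b q r → ((a :- q) :* (b :- q)) :* ((a :- r) :* (b :- r)) :=
             (a :* a :- (q :+ r) :* a :+ q :* r) :* (b :* b :- (q :+ r) :* b :+ q :* r)) refl a b q r ⟩
      (a * a - (q + r) * a + q * r) * (b * b - (q + r) * b + q * r)
        ≈⟨ *-cong (+-cong (+-congˡ (-‿cong (*-congʳ s≈0))) p≈1) (+-cong (+-congˡ (-‿cong (*-congʳ s≈0))) p≈1) ⟩
      (a * a - 0# * a + 1#) * (b * b - 0# * b + 1#)
        ≈⟨ solve 1 (λ x →
             ((x :- con (+ 1)) :* (x :- con (+ 1)) :* ((x :- con (+ 1)) :* (x :- con (+ 1))) :-
               con (+ 0) :* ((x :- con (+ 1)) :* (x :- con (+ 1))) :+ con (+ 1)) :*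
             ((x :+ con (+ 1)) :* (x :+ con (+ 1)) :* ((x :+ con (+ 1)) :* (x :+ con (+ 1))) :-
               con (+ 0) :* ((x :+ con (+ 1)) :* (x :+ con (+ 1))) :+ con (+ 1)) :=
             ((x :- con (+ 1)) :^ 4 :+ con (+ 1)) :* ((x :+ con (+ 1)) :^ 4 :+ con (+ 1))) refl x ⟩
      Solver.⟦ Poly.cycle⁴ᴾ ⟧ (x Vec.∷ Vec.[]) ∎
      where
      a b q r : Carrier
      a = (x - 1#) * (x - 1#)
      b = (x + 1#) * (x + 1#)
      q = ζ * ζ
      r = ξ * ξ

  cycle-cong : ∀ {l} .{{_ : ℕ.NonZero l}} {ρ τ : Vector Sign l} → (∀ i → ρ i ≡ τ i) → ∀ i j → cycle ρ i j ≡ cycle τ i j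
  cycle-cong {l} ρ≗τ i j = ≡.cong (λ s → if ⌊ toℕ j ℕₚ.≟ suc (toℕ i) ℕ.% l ⌋ then just s else nothing) (ρ≗τ i)

  -- The computed cases concern literal vectors, whereas `ρ` is a function that agrees with its
  -- table `ρ′` pointwise.
  hasCharPoly-cycle³ : ∀ (ρ : Vector Sign 3) → Negative ρ →
    HasCharPoly (cycle ρ) (λ x → Solver.⟦ Poly.cycle³ᴾ ⟧ (x Vec.∷ Vec.[]))
  hasCharPoly-cycle³ ρ neg = resp-≗ (cycle-cong {3} {ρ} {ρ′} ρ≗)
    (Poly.hasCharPoly (cycle ρ′) Poly.cycle³ᴾ (Poly.φᴾ-cycle³ (ρ zero) (ρ (suc zero)) (ρ (suc (suc zero))) neg))
    where
    ρ′ : Vector Sign 3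
    ρ′ = ρ zero ∷ ρ (suc zero) ∷ ρ (suc (suc zero)) ∷ []
    ρ≗ : ∀ i → ρ i ≡ ρ′ i
    ρ≗ zero             = ≡.refl
    ρ≗ (suc zero)       = ≡.refl
    ρ≗ (suc (suc zero)) = ≡.refl

  hasCharPoly-cycle⁴ : ∀ (ρ : Vector Sign 4) → Negative ρ →
    HasCharPoly (cycle ρ) (λ x → Solver.⟦ Poly.cycle⁴ᴾ ⟧ (x Vec.∷ Vec.[]))
  hasCharPoly-cycle⁴ ρ neg = resp-≗ (cycle-cong {4} {ρ} {ρ′} ρ≗)
    (Poly.hasCharPoly (cycle ρ′) Poly.cycle⁴ᴾ
      (Poly.φᴾ-cycle⁴ (ρ zero) (ρ (suc zero)) (ρ (suc (suc zero))) (ρ (suc (suc (suc zero)))) neg))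
    where
    ρ′ : Vector Sign 4
    ρ′ = ρ zero ∷ ρ (suc zero) ∷ ρ (suc (suc zero)) ∷ ρ (suc (suc (suc zero))) ∷ []
    ρ≗ : ∀ i → ρ i ≡ ρ′ i
    ρ≗ zero                   = ≡.refl
    ρ≗ (suc zero)             = ≡.refl
    ρ≗ (suc (suc zero))       = ≡.refl
    ρ≗ (suc (suc (suc zero))) = ≡.refl

  spectral-cycle³ : ∀ (ρ : Vector Sign 3) → Negative ρ → ∀ ω → ω * (1# - ω) ≈ 1# →
    Spectral (cycle ρ) (- 1# ∷ ω ∷ 1# - ω ∷ [])
  spectral-cycle³ ρ neg ω ω≈ = resp-≈ (λ x → sym (Roots.product-roots³ x ω ω≈)) (hasCharPoly-cycle³ ρ neg)

  spectral-cycle⁴ : ∀ (ρ : Vector Sign 4) → Negative ρ → ∀ ζ ξ → ζ * ζ + ξ * ξ ≈ 0# → (ζ * ζ) * (ξ * ξ) ≈ 1# →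
    Spectral (cycle ρ) (ζ ∷ - ζ ∷ ξ ∷ - ξ ∷ [])
  spectral-cycle⁴ ρ neg ζ ξ s≈0 p≈1 = resp-≈ (λ x → sym (Roots.product-roots⁴ x ζ ξ s≈0 p≈1)) (hasCharPoly-cycle⁴ ρ neg)

  -- Paths glued to negative cycles

  open Solver using (solve; _:+_; _:*_; _:-_; _:^_; _:=_; con)

  pathCycle-charPoly : ∀ {l n} .{{_ : ℕ.NonZero l}} {S : Sidigraph n} {f} →
    (∀ ρ → Negative ρ → HasCharPoly (cycle {l} ρ) f) → PathCycle l S →
    ∃[ m ] HasCharPoly S (λ x → product {m} (λ _ → pair x 0#) * f x)
  pathCycle-charPoly cyc (glue {k} τ v v-end ρ neg w) = suc k ,
    hasCharPoly-glue (suc k) _ (identify-path-oneWay τ v (cycle ρ) w v-end)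
      (spectral-acyclic (suc k) _ (identify-path-acyclic τ v (cycle ρ) w))
      (resp-≗ (identify-path-↑ʳ τ v (cycle ρ) w) (cyc ρ neg))

  -- `P` is carried along because the vector of eigenvalues is returned existentially; it will be
  -- `UnitRe`, the bound on real parts.
  pathCycle-spectral : ∀ {l n p} .{{_ : ℕ.NonZero l}} {S : Sidigraph n} {w : Vector Carrier l} (P : Carrier → Set p) →
    (∀ ρ → Negative ρ → Spectral (cycle {l} ρ) w) → P 0# → (∀ i → P (w i)) → PathCycle l S →
    ∃[ z ] Spectral S z × (∀ u → P (z u))
  pathCycle-spectral {w = λs} P cyc P0 Pλ (glue {k} τ v v-end ρ neg w) = (λ _ → 0#) ++ λs ,
    resp-≈ (product-++ (suc k) (λ _ → 0#) λs)
      (hasCharPoly-glue (suc k) _ (identify-path-oneWay τ v (cycle ρ) w v-end)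
        (spectral-acyclic (suc k) _ (identify-path-acyclic τ v (cycle ρ) w))
        (resp-≗ (identify-path-↑ʳ τ v (cycle ρ) w) (cyc ρ neg))) ,
    λ u → P-++ (splitAt (suc k) u)
    where
    P-++ : ∀ s → P ([ (λ _ → 0#) , λs ] s)
    P-++ (inj₁ _) = P0
    P-++ (inj₂ i) = Pλ i

  -- pair 0# 0# is -1, so the path contributes a sign at x = 0.
  product-pair-0² : ∀ m → product {m} (λ _ → pair 0# 0#) * product {m} (λ _ → pair 0# 0#) ≈ 1#
  product-pair-0² zero    = *-identityˡ 1#
  product-pair-0² (suc m) = begin
    (pair 0# 0# * q) * (pair 0# 0# * q)
      ≈⟨ solve 1 (λ q → let o = con (+ 0) ; i = con (+ 1) ; p = (o :- (o :+ i)) :* (o :- (o :- i)) in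
           (p :* q) :* (p :* q) := q :* q) refl q ⟩
    q * q
      ≈⟨ product-pair-0² m ⟩
    1# ∎
    where
    q = product {m} (λ _ → pair 0# 0#)

  pathCycle³-φ-0 : ∀ {n} {S : Sidigraph n} → PathCycle 3 S → φ S 0# ≈ 0#
  pathCycle³-φ-0 {S = S} path³ with m , p ← pathCycle-charPoly hasCharPoly-cycle³ path³ = trans (p .φ≈ 0#)
    (solve 1 (λ q → q :* (((con (+ 0) :- con (+ 1)) :^ 3 :+ con (+ 1)) :* ((con (+ 0) :+ con (+ 1)) :^ 3 :+ con (+ 1)))
      := con (+ 0)) refl (product {m} (λ _ → pair 0# 0#)))

  -- The multiplier is the path's own factor at 0. It turns the unknown sign into a square, which is
  -- 1, and leaves the value (1 + 1)(1 + 1) of the cycle factor.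
  pathCycle⁴-φ-0 : ∀ {n} {T : Sidigraph n} → PathCycle 4 T → ∃[ e ] e * φ T 0# ≈ (1# + 1#) * (1# + 1#)
  pathCycle⁴-φ-0 {T = T} path⁴ with m , p ← pathCycle-charPoly hasCharPoly-cycle⁴ path⁴ =
    let e = product {m} (λ _ → pair 0# 0#) in e , (begin
    e * φ T 0#
      ≈⟨ *-congˡ (p .φ≈ 0#) ⟩
    e * (e * Solver.⟦ Poly.cycle⁴ᴾ ⟧ (0# Vec.∷ Vec.[]))
      ≈⟨ solve 1 (λ q → let o = con (+ 0) ; i = con (+ 1) in
           q :* (q :* (((o :- i) :^ 4 :+ i) :* ((o :+ i) :^ 4 :+ i))) := q :* q :* ((i :+ i) :* (i :+ i))) refl e ⟩
    e * e * ((1# + 1#) * (1# + 1#))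
      ≈⟨ *-congʳ (product-pair-0² m) ⟩
    1# * ((1# + 1#) * (1# + 1#))
      ≈⟨ *-identityˡ _ ⟩
    (1# + 1#) * (1# + 1#) ∎)

  -- A common spectrum makes the two characteristic polynomials agree at 0. The conclusion stops at
  -- 4 = 0, which is a contradiction in ℂ but not in every commutative ring.
  cospectral⇒4≈0 : ∀ {n} {S T : Sidigraph n} {zs} → PathCycle 3 S → PathCycle 4 T →
    IsSpectrum (adj (S □ K₂)) zs → IsSpectrum (adj (T □ K₂)) zs → (1# + 1#) * (1# + 1#) ≈ 0#
  cospectral⇒4≈0 {S = S} {T} path³ path⁴ specS specT =
    let e , eφ≈4 = pathCycle⁴-φ-0 {T = T} path⁴ in begin
    (1# + 1#) * (1# + 1#)  ≈⟨ eφ≈4 ⟨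
    e * φ T 0#             ≈⟨ *-congˡ (trans (specT 0#) (sym (specS 0#))) ⟩
    e * φ S 0#             ≈⟨ *-congˡ (pathCycle³-φ-0 {S = S} path³) ⟩
    e * 0#                 ≈⟨ zeroʳ e ⟩
    0#                     ∎

-- Real and complex numbers

-- `x ≈ℝ y` unfolds to `Null` of the termwise difference, so the closure properties below are
-- properties of `≈ℝ`.
Null : (ℕ → ℚ) → Set
Null f = ∀ ε → 0ℚ ℚ.< ε → ∃[ N ] (∀ n → N ℕ.≤ n → ℚ.∣ f n ∣ ℚ.< ε)

null-resp : ∀ {f g} → (∀ n → f n ≡ g n) → Null f → Null g
null-resp f≗g f→0 ε 0<ε with f→0 ε 0<ε
... | N , h = N , λ n N≤n → ≡.subst (λ q → ℚ.∣ q ∣ ℚ.< ε) (f≗g n) (h n N≤n)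

null-zero : Null (λ _ → 0ℚ)
null-zero ε 0<ε = 0 , λ _ _ → 0<ε

null-neg : ∀ {f} → Null f → Null (λ n → ℚ.- f n)
null-neg {f} f→0 ε 0<ε with f→0 ε 0<ε
... | N , h = N , λ n N≤n → ≡.subst (ℚ._< ε) (≡.sym (ℚₚ.∣-p∣≡∣p∣ (f n))) (h n N≤n)

null-+ : ∀ {f g} → Null f → Null g → Null (λ n → f n ℚ.+ g n)
null-+ {f} {g} f→0 g→0 ε 0<ε with f→0 (½ ℚ.* ε) 0<½ε | g→0 (½ ℚ.* ε) 0<½ε
  where
  0<½ε : 0ℚ ℚ.< ½ ℚ.* ε
  0<½ε = ≡.subst (ℚ._< ½ ℚ.* ε) (ℚₚ.*-zeroʳ ½) (ℚₚ.*-monoʳ-<-pos ½ 0<ε)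
... | K , h | L , k = K ℕ.⊔ L , λ n N≤n → begin-strict
  ℚ.∣ f n ℚ.+ g n ∣             ≤⟨ ℚₚ.∣p+q∣≤∣p∣+∣q∣ (f n) (g n) ⟩
  ℚ.∣ f n ∣ ℚ.+ ℚ.∣ g n ∣       <⟨ ℚₚ.+-mono-< (h n (ℕₚ.m⊔n≤o⇒m≤o K L N≤n)) (k n (ℕₚ.m⊔n≤o⇒n≤o K L N≤n)) ⟩
  ½ ℚ.* ε ℚ.+ ½ ℚ.* ε           ≡⟨ ℚₚ.*-distribʳ-+ ε ½ ½ ⟨
  1ℚ ℚ.* ε                      ≡⟨ ℚₚ.*-identityˡ ε ⟩
  ε                             ∎
  where open ℚₚ.≤-Reasoning

null-scale : ∀ B → 0ℚ ℚ.< B → ∀ {f} → Null f → Null (λ n → B ℚ.* f n)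
null-scale B 0<B {f} f→0 ε 0<ε with f→0 (B⁻¹ ℚ.* ε) 0<B⁻¹ε
  module Scale where
  instance
    B-pos : ℚ.Positive B
    B-pos = ℚ.positive 0<B
    B-nonZero : ℚ.NonZero B
    B-nonZero = ℚₚ.pos⇒nonZero B
  B⁻¹ : ℚ
  B⁻¹ = ℚ.1/ B
  0<B⁻¹ε : 0ℚ ℚ.< B⁻¹ ℚ.* ε
  0<B⁻¹ε = ≡.subst (ℚ._< B⁻¹ ℚ.* ε) (ℚₚ.*-zeroʳ B⁻¹) (ℚₚ.*-monoʳ-<-pos B⁻¹ {{ℚₚ.1/pos⇒pos B}} 0<ε)
... | N , h = N , λ n N≤n → begin-strict
  ℚ.∣ B ℚ.* f n ∣               ≡⟨ ℚₚ.∣p*q∣≡∣p∣*∣q∣ B (f n) ⟩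
  ℚ.∣ B ∣ ℚ.* ℚ.∣ f n ∣         ≡⟨ ≡.cong (ℚ._* ℚ.∣ f n ∣) (ℚₚ.0≤p⇒∣p∣≡p (ℚₚ.<⇒≤ 0<B)) ⟩
  B ℚ.* ℚ.∣ f n ∣               <⟨ ℚₚ.*-monoʳ-<-pos B (h n N≤n) ⟩
  B ℚ.* (B⁻¹ ℚ.* ε)             ≡⟨ ℚₚ.*-assoc B B⁻¹ ε ⟨
  B ℚ.* B⁻¹ ℚ.* ε               ≡⟨ ≡.cong (ℚ._* ε) (ℚₚ.*-inverseʳ B) ⟩
  1ℚ ℚ.* ε                      ≡⟨ ℚₚ.*-identityˡ ε ⟩
  ε                             ∎
  where
  open ℚₚ.≤-Reasoning
  open Scale B 0<B f→0 ε 0<ε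

null-squeeze : ∀ {f g} M → (∀ n → M ℕ.≤ n → ℚ.∣ f n ∣ ℚ.≤ ℚ.∣ g n ∣) → Null g → Null f
null-squeeze M f≤g g→0 ε 0<ε with g→0 ε 0<ε
... | N , h = M ℕ.⊔ N , λ n N≤n →
  ℚₚ.≤-<-trans (f≤g n (ℕₚ.m⊔n≤o⇒m≤o M N N≤n)) (h n (ℕₚ.m⊔n≤o⇒n≤o M N N≤n))

cauchy⇒bounded : ∀ {f} → Cauchy f → ∃[ B ] ∃[ N ] (0ℚ ℚ.< B × (∀ n → N ℕ.≤ n → ℚ.∣ f n ∣ ℚ.≤ B))
cauchy⇒bounded {f} cf with cf 1ℚ (ℚₚ.positive⁻¹ 1ℚ)
... | N , h = ℚ.∣ f N ∣ ℚ.+ 1ℚ , N , ℚₚ.+-mono-≤-< (ℚₚ.0≤∣p∣ (f N)) (ℚₚ.positive⁻¹ 1ℚ) , λ n N≤n → begin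
  ℚ.∣ f n ∣                               ≡⟨ ≡.cong ℚ.∣_∣ (eq (f n) (f N)) ⟩
  ℚ.∣ f N ℚ.+ (f n ℚ.- f N) ∣             ≤⟨ ℚₚ.∣p+q∣≤∣p∣+∣q∣ (f N) (f n ℚ.- f N) ⟩
  ℚ.∣ f N ∣ ℚ.+ ℚ.∣ f n ℚ.- f N ∣         ≤⟨ ℚₚ.+-monoʳ-≤ ℚ.∣ f N ∣ (ℚₚ.<⇒≤ (h n N N≤n ℕₚ.≤-refl)) ⟩
  ℚ.∣ f N ∣ ℚ.+ 1ℚ                        ∎
  where
  open ℚₚ.≤-Reasoning
  open +-*-Solver
  eq : ∀ a b → a ≡ b ℚ.+ (a ℚ.- b)
  eq = solve 2 (λ a b → a := b :+ (a :+ :- b)) ≡.refl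

null-bounded-* : ∀ {f g} → Cauchy f → Null g → Null (λ n → f n ℚ.* g n)
null-bounded-* {f} {g} cf g→0 =
  let B , N , 0<B , f≤B = cauchy⇒bounded {f} cf
  in null-squeeze {λ n → f n ℚ.* g n} {λ n → B ℚ.* g n} N (λ n N≤n → begin
    ℚ.∣ f n ℚ.* g n ∣             ≡⟨ ℚₚ.∣p*q∣≡∣p∣*∣q∣ (f n) (g n) ⟩
    ℚ.∣ f n ∣ ℚ.* ℚ.∣ g n ∣       ≤⟨ ℚₚ.*-monoʳ-≤-nonNeg ℚ.∣ g n ∣ {{ℚₚ.∣-∣-nonNeg (g n)}} (f≤B n N≤n) ⟩
    B ℚ.* ℚ.∣ g n ∣               ≡⟨ ≡.cong (ℚ._* ℚ.∣ g n ∣) (ℚₚ.0≤p⇒∣p∣≡p (ℚₚ.<⇒≤ 0<B)) ⟨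
    ℚ.∣ B ∣ ℚ.* ℚ.∣ g n ∣         ≡⟨ ℚₚ.∣p*q∣≡∣p∣*∣q∣ B (g n) ⟨
    ℚ.∣ B ℚ.* g n ∣               ∎) (null-scale B 0<B {g} g→0)
  where open ℚₚ.≤-Reasoning

-- The complex numbers as a commutative ring

infix 4 _≐_
_≐_ : ℝ → ℝ → Set
x ≐ y = ∀ n → seq x n ≡ seq y n

-- The operations act termwise, so each ring law is an exact rational identity at every index;
-- limits matter only for congruence.
≐⇒≈ℝ : ∀ x y → x ≐ y → x ≈ℝ y
≐⇒≈ℝ x y x≐y = null-resp (λ n → ≡.sym (≡.trans (≡.cong (ℚ._- seq y n) (x≐y n)) (ℚₚ.+-inverseʳ (seq y n)))) null-zero

≈ℝ-refl : ∀ {x} → x ≈ℝ x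
≈ℝ-refl {x} = ≐⇒≈ℝ x x λ _ → ≡.refl

≈ℝ-sym : ∀ {x y} → x ≈ℝ y → y ≈ℝ x
≈ℝ-sym {x} {y} x≈y = null-resp (λ n → eq (seq x n) (seq y n)) (null-neg {λ n → seq x n ℚ.- seq y n} x≈y)
  where
  open +-*-Solver
  eq : ∀ a b → ℚ.- (a ℚ.- b) ≡ b ℚ.- a
  eq = solve 2 (λ a b → :- (a :+ :- b) := b :+ :- a) ≡.refl

≈ℝ-trans : ∀ {x y z} → x ≈ℝ y → y ≈ℝ z → x ≈ℝ z
≈ℝ-trans {x} {y} {z} x≈y y≈z = null-resp (λ n → eq (seq x n) (seq y n) (seq z n))
  (null-+ {λ n → seq x n ℚ.- seq y n} {λ n → seq y n ℚ.- seq z n} x≈y y≈z)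
  where
  open +-*-Solver
  eq : ∀ a b c → (a ℚ.- b) ℚ.+ (b ℚ.- c) ≡ a ℚ.- c
  eq = solve 3 (λ a b c → (a :+ :- b) :+ (b :+ :- c) := a :+ :- c) ≡.refl

+ℝ-cong : ∀ x x′ y y′ → x ≈ℝ x′ → y ≈ℝ y′ → x +ℝ y ≈ℝ x′ +ℝ y′
+ℝ-cong x x′ y y′ x≈x′ y≈y′ = null-resp (λ n → eq (seq x n) (seq x′ n) (seq y n) (seq y′ n))
  (null-+ {λ n → seq x n ℚ.- seq x′ n} {λ n → seq y n ℚ.- seq y′ n} x≈x′ y≈y′)
  where
  open +-*-Solver
  eq : ∀ a b c d → (a ℚ.- b) ℚ.+ (c ℚ.- d) ≡ (a ℚ.+ c) ℚ.- (b ℚ.+ d)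
  eq = solve 4 (λ a b c d → (a :+ :- b) :+ (c :+ :- d) := (a :+ c) :+ :- (b :+ d)) ≡.refl

*ℝ-cong : ∀ x x′ y y′ → x ≈ℝ x′ → y ≈ℝ y′ → x *ℝ y ≈ℝ x′ *ℝ y′
*ℝ-cong x x′ y y′ x≈x′ y≈y′ = null-resp (λ n → eq (seq x n) (seq x′ n) (seq y n) (seq y′ n))
  (null-+ {λ n → seq x n ℚ.* (seq y n ℚ.- seq y′ n)} {λ n → seq y′ n ℚ.* (seq x n ℚ.- seq x′ n)}
    (null-bounded-* {seq x} (cauchy x) y≈y′) (null-bounded-* {seq y′} (cauchy y′) x≈x′))
  where
  open +-*-Solver
  eq : ∀ a b c d → a ℚ.* (c ℚ.- d) ℚ.+ d ℚ.* (a ℚ.- b) ≡ a ℚ.* c ℚ.- b ℚ.* d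
  eq = solve 4 (λ a b c d → a :* (c :+ :- d) :+ d :* (a :+ :- b) := a :* c :+ :- (b :* d)) ≡.refl

-ℝ-cong : ∀ x y → x ≈ℝ y → -ℝ x ≈ℝ -ℝ y
-ℝ-cong x y x≈y = null-resp (λ n → eq (seq x n) (seq y n)) (null-neg {λ n → seq x n ℚ.- seq y n} x≈y)
  where
  open +-*-Solver
  eq : ∀ a b → ℚ.- (a ℚ.- b) ≡ ℚ.- a ℚ.- ℚ.- b
  eq = solve 2 (λ a b → :- (a :+ :- b) := :- a :+ :- (:- b)) ≡.refl

infix 4 _≈ℂ_
_≈ℂ_ : ℂ → ℂ → Set
z ≈ℂ w = (re z ≈ℝ re w) × (im z ≈ℝ im w)

≐⇒≈ℂ : ∀ z w → re z ≐ re w → im z ≐ im w → z ≈ℂ w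
≐⇒≈ℂ z w r i = ≐⇒≈ℝ (re z) (re w) r , ≐⇒≈ℝ (im z) (im w) i

ℂ-isCommutativeRing : let open RawRing ℂ-rawRing in IsCommutativeRing _≈ℂ_ _+_ _*_ -_ 0# 1#
ℂ-isCommutativeRing = record
  { isRing = record
    { +-isAbelianGroup = record
      { isGroup = record
        { isMonoid = record
          { isSemigroup = record
            { isMagma = record
              { isEquivalence = record
                { refl  = λ {z} → ≈ℝ-refl {re z} , ≈ℝ-refl {im z}
                ; sym   = λ {z} {w} (p , q) → ≈ℝ-sym {re z} {re w} p , ≈ℝ-sym {im z} {im w} q
                ; trans = λ {z} {w} {v} (p , q) (p′ , q′) →
                    ≈ℝ-trans {re z} {re w} {re v} p p′ , ≈ℝ-trans {im z} {im w} {im v} q q′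
                }
              ; ∙-cong = λ {z} {z′} {w} {w′} (p , q) (p′ , q′) →
                  +ℝ-cong (re z) (re z′) (re w) (re w′) p p′ , +ℝ-cong (im z) (im z′) (im w) (im w′) q q′
              }
            ; assoc = λ z w v → ≐⇒≈ℂ ((z + w) + v) (z + (w + v))
                (λ n → ℚₚ.+-assoc (seq (re z) n) (seq (re w) n) (seq (re v) n))
                (λ n → ℚₚ.+-assoc (seq (im z) n) (seq (im w) n) (seq (im v) n))
            }
          ; identity = (λ z → ≐⇒≈ℂ (0# + z) z (λ n → ℚₚ.+-identityˡ (seq (re z) n)) (λ n → ℚₚ.+-identityˡ (seq (im z) n)))
                     , (λ z → ≐⇒≈ℂ (z + 0#) z (λ n → ℚₚ.+-identityʳ (seq (re z) n)) (λ n → ℚₚ.+-identityʳ (seq (im z) n)))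
          }
        ; inverse = (λ z → ≐⇒≈ℂ (- z + z) 0# (λ n → ℚₚ.+-inverseˡ (seq (re z) n)) (λ n → ℚₚ.+-inverseˡ (seq (im z) n)))
                  , (λ z → ≐⇒≈ℂ (z + - z) 0# (λ n → ℚₚ.+-inverseʳ (seq (re z) n)) (λ n → ℚₚ.+-inverseʳ (seq (im z) n)))
        ; ⁻¹-cong = λ {z} {w} (p , q) → -ℝ-cong (re z) (re w) p , -ℝ-cong (im z) (im w) q
        }
      ; comm = λ z w → ≐⇒≈ℂ (z + w) (w + z) (λ n → ℚₚ.+-comm (seq (re z) n) (seq (re w) n))
                                 (λ n → ℚₚ.+-comm (seq (im z) n) (seq (im w) n))
      }
    ; *-cong = λ {z} {z′} {w} {w′} (p , q) (p′ , q′) →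
        +ℝ-cong (re z *ℝ re w) (re z′ *ℝ re w′) (-ℝ (im z *ℝ im w)) (-ℝ (im z′ *ℝ im w′))
          (*ℝ-cong (re z) (re z′) (re w) (re w′) p p′)
          (-ℝ-cong (im z *ℝ im w) (im z′ *ℝ im w′) (*ℝ-cong (im z) (im z′) (im w) (im w′) q q′))
      , +ℝ-cong (re z *ℝ im w) (re z′ *ℝ im w′) (im z *ℝ re w) (im z′ *ℝ re w′)
          (*ℝ-cong (re z) (re z′) (im w) (im w′) p q′)
          (*ℝ-cong (im z) (im z′) (re w) (re w′) q p′)
    ; *-assoc = λ z w v → ≐⇒≈ℂ ((z * w) * v) (z * (w * v))
        (λ n → assoc-re (seq (re z) n) (seq (im z) n) (seq (re w) n) (seq (im w) n) (seq (re v) n) (seq (im v) n))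
        (λ n → assoc-im (seq (re z) n) (seq (im z) n) (seq (re w) n) (seq (im w) n) (seq (re v) n) (seq (im v) n))
    ; *-identity = (λ z → ≐⇒≈ℂ (1# * z) z (λ n → idˡ-re (seq (re z) n) (seq (im z) n)) (λ n → idˡ-im (seq (re z) n) (seq (im z) n)))
                 , (λ z → ≐⇒≈ℂ (z * 1#) z (λ n → idʳ-re (seq (re z) n) (seq (im z) n)) (λ n → idʳ-im (seq (re z) n) (seq (im z) n)))
    ; distrib = (λ z w v → ≐⇒≈ℂ (z * (w + v)) (z * w + z * v)
          (λ n → distˡ-re (seq (re z) n) (seq (im z) n) (seq (re w) n) (seq (im w) n) (seq (re v) n) (seq (im v) n))
          (λ n → distˡ-im (seq (re z) n) (seq (im z) n) (seq (re w) n) (seq (im w) n) (seq (re v) n) (seq (im v) n)))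
      , (λ z w v → ≐⇒≈ℂ ((w + v) * z) (w * z + v * z)
          (λ n → distʳ-re (seq (re z) n) (seq (im z) n) (seq (re w) n) (seq (im w) n) (seq (re v) n) (seq (im v) n))
          (λ n → distʳ-im (seq (re z) n) (seq (im z) n) (seq (re w) n) (seq (im w) n) (seq (re v) n) (seq (im v) n)))
    }
  ; *-comm = λ z w → ≐⇒≈ℂ (z * w) (w * z)
      (λ n → comm-re (seq (re z) n) (seq (im z) n) (seq (re w) n) (seq (im w) n))
      (λ n → comm-im (seq (re z) n) (seq (im z) n) (seq (re w) n) (seq (im w) n))
  }
  where
  open RawRing ℂ-rawRing
  open +-*-Solver
  assoc-re : ∀ a b c d e f → (a ℚ.* c ℚ.- b ℚ.* d) ℚ.* e ℚ.- (a ℚ.* d ℚ.+ b ℚ.* c) ℚ.* f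
                           ≡ a ℚ.* (c ℚ.* e ℚ.- d ℚ.* f) ℚ.- b ℚ.* (c ℚ.* f ℚ.+ d ℚ.* e)
  assoc-re = solve 6 (λ a b c d e f → ((a :* c :- (b :* d)) :* e :- ((a :* d :+ b :* c) :* f)) :=
                                      (a :* (c :* e :- (d :* f)) :- (b :* (c :* f :+ d :* e)))) ≡.refl
  assoc-im : ∀ a b c d e f → (a ℚ.* c ℚ.- b ℚ.* d) ℚ.* f ℚ.+ (a ℚ.* d ℚ.+ b ℚ.* c) ℚ.* e
                           ≡ a ℚ.* (c ℚ.* f ℚ.+ d ℚ.* e) ℚ.+ b ℚ.* (c ℚ.* e ℚ.- d ℚ.* f)
  assoc-im = solve 6 (λ a b c d e f → (a :* c :- (b :* d)) :* f :+ (a :* d :+ b :* c) :* e :=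
                                      a :* (c :* f :+ d :* e) :+ b :* (c :* e :- (d :* f))) ≡.refl
  idˡ-re : ∀ a b → 1ℚ ℚ.* a ℚ.- 0ℚ ℚ.* b ≡ a
  idˡ-re = solve 2 (λ a b → (con 1ℚ :* a :- (con 0ℚ :* b)) := a) ≡.refl
  idˡ-im : ∀ a b → 1ℚ ℚ.* b ℚ.+ 0ℚ ℚ.* a ≡ b
  idˡ-im = solve 2 (λ a b → con 1ℚ :* b :+ con 0ℚ :* a := b) ≡.refl
  idʳ-re : ∀ a b → a ℚ.* 1ℚ ℚ.- b ℚ.* 0ℚ ≡ a
  idʳ-re = solve 2 (λ a b → (a :* con 1ℚ :- (b :* con 0ℚ)) := a) ≡.refl
  idʳ-im : ∀ a b → a ℚ.* 0ℚ ℚ.+ b ℚ.* 1ℚ ≡ b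
  idʳ-im = solve 2 (λ a b → a :* con 0ℚ :+ b :* con 1ℚ := b) ≡.refl
  distˡ-re : ∀ a b c d e f → a ℚ.* (c ℚ.+ e) ℚ.- b ℚ.* (d ℚ.+ f) ≡ (a ℚ.* c ℚ.- b ℚ.* d) ℚ.+ (a ℚ.* e ℚ.- b ℚ.* f)
  distˡ-re = solve 6 (λ a b c d e f → (a :* (c :+ e) :- (b :* (d :+ f))) := (a :* c :- (b :* d)) :+ (a :* e :- (b :* f))) ≡.refl
  distˡ-im : ∀ a b c d e f → a ℚ.* (d ℚ.+ f) ℚ.+ b ℚ.* (c ℚ.+ e) ≡ (a ℚ.* d ℚ.+ b ℚ.* c) ℚ.+ (a ℚ.* f ℚ.+ b ℚ.* e)
  distˡ-im = solve 6 (λ a b c d e f → a :* (d :+ f) :+ b :* (c :+ e) := (a :* d :+ b :* c) :+ (a :* f :+ b :* e)) ≡.refl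
  distʳ-re : ∀ a b c d e f → (c ℚ.+ e) ℚ.* a ℚ.- (d ℚ.+ f) ℚ.* b ≡ (c ℚ.* a ℚ.- d ℚ.* b) ℚ.+ (e ℚ.* a ℚ.- f ℚ.* b)
  distʳ-re = solve 6 (λ a b c d e f → ((c :+ e) :* a :- ((d :+ f) :* b)) := (c :* a :- (d :* b)) :+ (e :* a :- (f :* b))) ≡.refl
  distʳ-im : ∀ a b c d e f → (c ℚ.+ e) ℚ.* b ℚ.+ (d ℚ.+ f) ℚ.* a ≡ (c ℚ.* b ℚ.+ d ℚ.* a) ℚ.+ (e ℚ.* b ℚ.+ f ℚ.* a)
  distʳ-im = solve 6 (λ a b c d e f → (c :+ e) :* b :+ (d :+ f) :* a := (c :* b :+ d :* a) :+ (e :* b :+ f :* a)) ≡.refl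
  comm-re : ∀ a b c d → a ℚ.* c ℚ.- b ℚ.* d ≡ c ℚ.* a ℚ.- d ℚ.* b
  comm-re = solve 4 (λ a b c d → (a :* c :- (b :* d)) := (c :* a :- (d :* b))) ≡.refl
  comm-im : ∀ a b c d → a ℚ.* d ℚ.+ b ℚ.* c ≡ c ℚ.* b ℚ.+ d ℚ.* a
  comm-im = solve 4 (λ a b c d → a :* d :+ b :* c := c :* b :+ d :* a) ≡.refl

ℂ-commutativeRing : CommutativeRing 0ℓ 0ℓ
ℂ-commutativeRing = record { isCommutativeRing = ℂ-isCommutativeRing }

-- Geometric convergence and square roots

unitFraction : ℕ → ℚ
unitFraction n = mkℚ (+ 1) n (1-coprimeTo (suc n))

½*unitFraction≤ : ∀ n → ½ ℚ.* unitFraction n ℚ.≤ unitFraction (suc n)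
½*unitFraction≤ n = ℚₚ.toℚᵘ-cancel-≤ (ℚᵘₚ.≤-respˡ-≃ (ℚᵘₚ.≃-sym (ℚₚ.toℚᵘ-homo-* ½ (unitFraction n)))
  (ℚᵘ.*≤* (ℤ.+≤+ (s≤s (ℕₚ.+-monoˡ-≤ 0 (ℕₚ.≤-trans (s≤s (ℕₚ.m≤n+m n n)) (ℕₚ.≤-reflexive (eq n))))))))
  where
  eq : ∀ n → suc (n ℕ.+ n) ≡ n ℕ.+ suc (n ℕ.+ 0)
  eq n = ≡.trans (≡.sym (ℕₚ.+-suc n n)) (≡.cong (λ m → n ℕ.+ suc m) (≡.sym (ℕₚ.+-identityʳ n)))

½^ : ℕ → ℚ
½^ zero    = 1ℚ
½^ (suc n) = ½ ℚ.* ½^ n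

-- Bounding by 1/(n + 1) makes the Archimedean step explicit: the denominator of ε becomes an index
-- from which the powers stay below ε.
½^≤unitFraction : ∀ n → ½^ n ℚ.≤ unitFraction n
½^≤unitFraction zero    = ℚₚ.≤-refl
½^≤unitFraction (suc n) = ℚₚ.≤-trans (ℚₚ.*-monoˡ-≤-nonNeg ½ (½^≤unitFraction n)) (½*unitFraction≤ n)

0≤½^ : ∀ n → 0ℚ ℚ.≤ ½^ n
0≤½^ zero    = ℚₚ.nonNegative⁻¹ 1ℚ
0≤½^ (suc n) = ≡.subst (ℚ._≤ ½ ℚ.* ½^ n) (ℚₚ.*-zeroʳ ½) (ℚₚ.*-monoˡ-≤-nonNeg ½ (0≤½^ n))

unitFraction-< : ∀ {m n} → m ℕ.< n → unitFraction n ℚ.< unitFraction m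
unitFraction-< {m} {n} m<n = ℚ.*<* (ℤ.+<+ (s≤s (ℕₚ.+-monoˡ-< 0 m<n)))

unitFraction≤ : ∀ ε → 0ℚ ℚ.< ε → unitFraction (ℚ.denominator-1 ε) ℚ.≤ ε
unitFraction≤ (mkℚ +[1+ a ] d c) _ = ℚ.*≤* (ℤ.+≤+ (ℕₚ.*-monoˡ-≤ (suc d) (s≤s (z≤n {a}))))
unitFraction≤ (mkℚ ℤ.+0 d c) 0<ε with () ← ℚ.positive 0<ε
unitFraction≤ (mkℚ -[1+ a ] d c) 0<ε with () ← ℚ.positive 0<ε

null-½^ : Null ½^
-- If d + 1 is the denominator of ε, then 1/(d + 1) ≤ ε; starting one past d makes the final
-- inequality strict.
null-½^ ε 0<ε = suc (ℚ.denominator-1 ε) , λ n N≤n → begin-strict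
  ℚ.∣ ½^ n ∣                          ≡⟨ ℚₚ.0≤p⇒∣p∣≡p (0≤½^ n) ⟩
  ½^ n                                ≤⟨ ½^≤unitFraction n ⟩
  unitFraction n                      <⟨ unitFraction-< N≤n ⟩
  unitFraction (ℚ.denominator-1 ε)    ≤⟨ unitFraction≤ ε 0<ε ⟩
  ε                                   ∎
  where open ℚₚ.≤-Reasoning

module _ (f : ℕ → ℚ) (step : ∀ n → ℚ.∣ f (suc n) ℚ.- f n ∣ ℚ.≤ ½^ n) where
  open ℚₚ.≤-Reasoning

  private
    -- The bound is the sum of the whole geometric tail from n. It does not depend on k, and the
    -- induction closes because twice the next power is the current one.
    tail-≤ : ∀ k n → ℚ.∣ f (k ℕ.+ n) ℚ.- f n ∣ ℚ.≤ ½^ n ℚ.+ ½^ n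
    tail-≤ zero n = begin
      ℚ.∣ f n ℚ.- f n ∣     ≡⟨ ≡.cong ℚ.∣_∣ (ℚₚ.+-inverseʳ (f n)) ⟩
      0ℚ                    ≤⟨ ℚₚ.+-mono-≤ (0≤½^ n) (0≤½^ n) ⟩
      ½^ n ℚ.+ ½^ n         ∎
    tail-≤ (suc k) n = begin
      ℚ.∣ f (suc k ℕ.+ n) ℚ.- f n ∣
        ≡⟨ ≡.cong₂ (λ m q → ℚ.∣ f m ℚ.- q ∣) (≡.sym (ℕₚ.+-suc k n)) ≡.refl ⟩
      ℚ.∣ f (k ℕ.+ suc n) ℚ.- f n ∣
        ≡⟨ ≡.cong ℚ.∣_∣ (split (f (k ℕ.+ suc n)) (f (suc n)) (f n)) ⟩
      ℚ.∣ (f (k ℕ.+ suc n) ℚ.- f (suc n)) ℚ.+ (f (suc n) ℚ.- f n) ∣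
        ≤⟨ ℚₚ.∣p+q∣≤∣p∣+∣q∣ (f (k ℕ.+ suc n) ℚ.- f (suc n)) (f (suc n) ℚ.- f n) ⟩
      ℚ.∣ f (k ℕ.+ suc n) ℚ.- f (suc n) ∣ ℚ.+ ℚ.∣ f (suc n) ℚ.- f n ∣
        ≤⟨ ℚₚ.+-mono-≤ (tail-≤ k (suc n)) (step n) ⟩
      (½ ℚ.* ½^ n ℚ.+ ½ ℚ.* ½^ n) ℚ.+ ½^ n
        ≡⟨ halves (½^ n) ⟩
      ½^ n ℚ.+ ½^ n ∎
      where
      open +-*-Solver
      split : ∀ a b c → a ℚ.- c ≡ (a ℚ.- b) ℚ.+ (b ℚ.- c)
      split = solve 3 (λ a b c → a :- c := (a :- b) :+ (b :- c)) ≡.refl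
      halves : ∀ h → (½ ℚ.* h ℚ.+ ½ ℚ.* h) ℚ.+ h ≡ h ℚ.+ h
      halves = solve 1 (λ h → (con ½ :* h :+ con ½ :* h) :+ h := h :+ h) ≡.refl

    tail-≤′ : ∀ m n → n ℕ.≤ m → ℚ.∣ f m ℚ.- f n ∣ ℚ.≤ ½^ n ℚ.+ ½^ n
    tail-≤′ m n n≤m = ≡.subst (λ m → ℚ.∣ f m ℚ.- f n ∣ ℚ.≤ ½^ n ℚ.+ ½^ n) (ℕₚ.m∸n+n≡m n≤m) (tail-≤ (m ℕ.∸ n) n)

  geometric⇒cauchy : Cauchy f
  -- Both indices are compared with `N`, each at the cost of two copies of `½^ N`; hence the null
  -- sequence with four copies.
  geometric⇒cauchy ε 0<ε with null-+ {λ n → ½^ n ℚ.+ ½^ n} {λ n → ½^ n ℚ.+ ½^ n}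
                                (null-+ {½^} {½^} null-½^ null-½^) (null-+ {½^} {½^} null-½^ null-½^) ε 0<ε
  ... | N , h = N , λ m n N≤m N≤n → begin-strict
    ℚ.∣ f m ℚ.- f n ∣
      ≡⟨ ≡.cong ℚ.∣_∣ (split (f m) (f n) (f N)) ⟩
    ℚ.∣ (f m ℚ.- f N) ℚ.- (f n ℚ.- f N) ∣
      ≤⟨ ℚₚ.∣p-q∣≤∣p∣+∣q∣ (f m ℚ.- f N) (f n ℚ.- f N) ⟩
    ℚ.∣ f m ℚ.- f N ∣ ℚ.+ ℚ.∣ f n ℚ.- f N ∣
      ≤⟨ ℚₚ.+-mono-≤ (tail-≤′ m N N≤m) (tail-≤′ n N N≤n) ⟩
    (½^ N ℚ.+ ½^ N) ℚ.+ (½^ N ℚ.+ ½^ N)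
      ≡⟨ ℚₚ.0≤p⇒∣p∣≡p (ℚₚ.+-mono-≤ (ℚₚ.+-mono-≤ (0≤½^ N) (0≤½^ N)) (ℚₚ.+-mono-≤ (0≤½^ N) (0≤½^ N))) ⟨
    ℚ.∣ (½^ N ℚ.+ ½^ N) ℚ.+ (½^ N ℚ.+ ½^ N) ∣
      <⟨ h N ℕₚ.≤-refl ⟩
    ε ∎
    where
    open +-*-Solver
    split : ∀ a b c → a ℚ.- b ≡ (a ℚ.- c) ℚ.- (b ℚ.- c)
    split = solve 3 (λ a b c → a :- b := (a :- c) :- (b :- c)) ≡.refl

-- For 0 ≤ c ≤ ½ the iteration u ↦ (c + u²)/2 stays in [0,½] and contracts by ½ there;
-- its fixed point u satisfies (1 - u)² = 1 - c.
module SquareRoot (c : ℚ) (0≤c : 0ℚ ℚ.≤ c) (c≤½ : c ℚ.≤ ½) where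
  open ℚₚ.≤-Reasoning

  u : ℕ → ℚ
  u zero    = 0ℚ
  u (suc n) = ½ ℚ.* (c ℚ.+ u n ℚ.* u n)

  private
    *-mono-≤ : ∀ {p q r s} → 0ℚ ℚ.≤ p → 0ℚ ℚ.≤ s → p ℚ.≤ q → r ℚ.≤ s → p ℚ.* r ℚ.≤ q ℚ.* s
    *-mono-≤ {p} {q} {r} {s} 0≤p 0≤s p≤q r≤s = ℚₚ.≤-trans
      (ℚₚ.*-monoˡ-≤-nonNeg p {{ℚ.nonNegative 0≤p}} r≤s) (ℚₚ.*-monoʳ-≤-nonNeg s {{ℚ.nonNegative 0≤s}} p≤q)

    0≤½ : 0ℚ ℚ.≤ ½
    0≤½ = ℚₚ.nonNegative⁻¹ ½

    bounds : ∀ n → 0ℚ ℚ.≤ u n × u n ℚ.≤ ½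
    bounds zero    = ℚₚ.≤-refl , 0≤½
    bounds (suc n) = let 0≤u , u≤½ = bounds n in
        ℚₚ.*-monoˡ-≤-nonNeg ½ (ℚₚ.+-mono-≤ 0≤c (*-mono-≤ ℚₚ.≤-refl 0≤u 0≤u 0≤u))
      -- The value to compare with ½ is ½ · (½ + ¼) = 3/8.
      , ℚₚ.≤-trans (ℚₚ.*-monoˡ-≤-nonNeg ½ (ℚₚ.+-mono-≤ c≤½ (*-mono-≤ 0≤u 0≤½ u≤½ u≤½)))
                   (ℚₚ.≤ᵇ⇒≤ _)

    increment-≤ : ∀ n → ℚ.∣ u (suc n) ℚ.- u n ∣ ℚ.≤ ½^ n
    increment-≤ zero = begin
      ℚ.∣ u 1 ℚ.- 0ℚ ∣       ≡⟨ ≡.cong ℚ.∣_∣ (ℚₚ.+-identityʳ (u 1)) ⟩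
      ℚ.∣ u 1 ∣              ≡⟨ ℚₚ.0≤p⇒∣p∣≡p (proj₁ (bounds 1)) ⟩
      u 1                    ≤⟨ proj₂ (bounds 1) ⟩
      ½                      ≤⟨ ℚₚ.≤ᵇ⇒≤ _ ⟩
      1ℚ                     ∎
    increment-≤ (suc n) = begin
      ℚ.∣ u (suc (suc n)) ℚ.- u (suc n) ∣
        ≡⟨ ≡.cong ℚ.∣_∣ (factor (u (suc n)) (u n) c) ⟩
      ℚ.∣ ½ ℚ.* (u (suc n) ℚ.+ u n) ℚ.* (u (suc n) ℚ.- u n) ∣
        ≡⟨ ℚₚ.∣p*q∣≡∣p∣*∣q∣ (½ ℚ.* (u (suc n) ℚ.+ u n)) (u (suc n) ℚ.- u n) ⟩
      ℚ.∣ ½ ℚ.* (u (suc n) ℚ.+ u n) ∣ ℚ.* ℚ.∣ u (suc n) ℚ.- u n ∣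
        ≡⟨ ≡.cong (ℚ._* ℚ.∣ u (suc n) ℚ.- u n ∣) (ℚₚ.0≤p⇒∣p∣≡p 0≤w) ⟩
      ½ ℚ.* (u (suc n) ℚ.+ u n) ℚ.* ℚ.∣ u (suc n) ℚ.- u n ∣
        ≤⟨ *-mono-≤ 0≤w (0≤½^ n) w≤½ (increment-≤ n) ⟩
      ½ ℚ.* ½^ n ∎
      where
      0≤w : 0ℚ ℚ.≤ ½ ℚ.* (u (suc n) ℚ.+ u n)
      0≤w = ℚₚ.*-monoˡ-≤-nonNeg ½ (ℚₚ.+-mono-≤ (proj₁ (bounds (suc n))) (proj₁ (bounds n)))
      w≤½ : ½ ℚ.* (u (suc n) ℚ.+ u n) ℚ.≤ ½
      w≤½ = ℚₚ.*-monoˡ-≤-nonNeg ½ (ℚₚ.+-mono-≤ (proj₂ (bounds (suc n))) (proj₂ (bounds n)))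
      open +-*-Solver
      factor : ∀ v w c → ½ ℚ.* (c ℚ.+ v ℚ.* v) ℚ.- ½ ℚ.* (c ℚ.+ w ℚ.* w) ≡ ½ ℚ.* (v ℚ.+ w) ℚ.* (v ℚ.- w)
      factor = solve 3 (λ v w c → con ½ :* (c :+ v :* v) :- con ½ :* (c :+ w :* w) := con ½ :* (v :+ w) :* (v :- w)) ≡.refl

  √ : ℝ
  √ = 1ℝ +ℝ -ℝ mkℝ u (geometric⇒cauchy u increment-≤)

  -- At each index the error (1 - u)² - (1 - c) is exactly twice the next increment of the
  -- iteration, and the increments tend to 0.
  √*√ : √ *ℝ √ ≈ℝ fromℚ (1ℚ ℚ.- c)
  √*√ = null-resp (λ n → ≡.sym (eq c (u n))) (null-+ {d} {d} d→0 d→0)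
    where
    d : ℕ → ℚ
    d n = u (suc n) ℚ.- u n
    d→0 : Null d
    d→0 = null-squeeze {d} {½^} 0 (λ n _ → ≡.subst (ℚ.∣ d n ∣ ℚ.≤_) (≡.sym (ℚₚ.0≤p⇒∣p∣≡p (0≤½^ n))) (increment-≤ n)) null-½^
    open +-*-Solver
    eq : ∀ c u → (1ℚ ℚ.- u) ℚ.* (1ℚ ℚ.- u) ℚ.- (1ℚ ℚ.- c) ≡ (½ ℚ.* (c ℚ.+ u ℚ.* u) ℚ.- u) ℚ.+ (½ ℚ.* (c ℚ.+ u ℚ.* u) ℚ.- u)
    eq = solve 2 (λ c u → (con 1ℚ :- u) :* (con 1ℚ :- u) :- (con 1ℚ :- c) :=
      (con ½ :* (c :+ u :* u) :- u) :+ (con ½ :* (c :+ u :* u) :- u)) ≡.refl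

  0≤√ : ∀ n → 0ℚ ℚ.≤ seq √ n
  0≤√ n = ℚₚ.≤-trans 0≤½ (ℚₚ.+-monoʳ-≤ 1ℚ (ℚₚ.neg-antimono-≤ (proj₂ (bounds n))))

  √≤1 : ∀ n → seq √ n ℚ.≤ 1ℚ
  √≤1 n = ℚₚ.+-monoʳ-≤ 1ℚ (ℚₚ.neg-antimono-≤ (proj₁ (bounds n)))

-- The energy of S □ K₂

open import Data.Nat.Base using (_≤_; _*_)
open CommutativeRing ℂ-commutativeRing using (_≈_)
  renaming (_+_ to _⊕_; _*_ to _⊗_; -_ to ⊖_; _-_ to _⊝_; 0# to 0ℂ; 1# to 1ℂ)

σ+ : signℂ Sign.+ ≈ 1ℂ
σ+ = CommutativeRing.refl ℂ-commutativeRing {1ℂ}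

σ- : signℂ Sign.- ≈ ⊖ 1ℂ
σ- = CommutativeRing.refl ℂ-commutativeRing {⊖ 1ℂ}

open Spectrum ℂ-commutativeRing signℂ σ+ σ-

-1≤_≤1 : ℚ → Set
-1≤ q ≤1 = ℚ.- 1ℚ ℚ.≤ q × q ℚ.≤ 1ℚ

-- The bound is imposed on every term of the sequence rather than up to `≈ℝ`, which lets `energy-2n`
-- be an exact equality at each index.
UnitRe : ℂ → Set
UnitRe z = ∀ n → -1≤ seq (re z) n ≤1

∣q+1∣+∣q-1∣ : ∀ q → -1≤ q ≤1 → ℚ.∣ q ℚ.+ 1ℚ ∣ ℚ.+ ℚ.∣ q ℚ.- 1ℚ ∣ ≡ 1ℚ ℚ.+ 1ℚ
∣q+1∣+∣q-1∣ q (-1≤q , q≤1) = begin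
  ℚ.∣ q ℚ.+ 1ℚ ∣ ℚ.+ ℚ.∣ q ℚ.- 1ℚ ∣
    ≡⟨ ≡.cong₂ ℚ._+_ (ℚₚ.0≤p⇒∣p∣≡p (ℚₚ.+-monoˡ-≤ 1ℚ -1≤q))
         (≡.trans (≡.sym (ℚₚ.∣-p∣≡∣p∣ (q ℚ.- 1ℚ)))
           (ℚₚ.0≤p⇒∣p∣≡p (ℚₚ.neg-antimono-≤ (ℚₚ.+-monoˡ-≤ (ℚ.- 1ℚ) q≤1)))) ⟩
  (q ℚ.+ 1ℚ) ℚ.+ ℚ.- (q ℚ.- 1ℚ)
    ≡⟨ solve 1 (λ q → (q :+ con 1ℚ) :+ :- (q :- con 1ℚ) := con 1ℚ :+ con 1ℚ) ≡.refl q ⟩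
  1ℚ ℚ.+ 1ℚ ∎
  where
  open ≡.≡-Reasoning
  open +-*-Solver

suc/1 : ∀ n → (+ suc n) ℚ./ 1 ≡ 1ℚ ℚ.+ (+ n) ℚ./ 1
suc/1 n = begin
  (+ suc n) ℚ./ 1              ≡⟨ ≡.cong (λ i → (+ 1 ℤ.+ i) ℚ./ 1) (ℤₚ.*-identityʳ (+ n)) ⟨
  1ℚ ℚ.+ n/1                   ≡⟨ ≡.cong (1ℚ ℚ.+_) (ℚₚ.fromℚᵘ-toℚᵘ n/1) ⟨
  1ℚ ℚ.+ (+ n) ℚ./ 1           ∎
  where
  open ≡.≡-Reasoning
  -- For a variable n the fraction `(+ n) ℚ./ 1` is stuck on its normalisation; given in lowest
  -- terms, it can be added by computation.
  n/1 : ℚ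
  n/1 = mkℚ (+ n) 0 (Coprimality.sym (1-coprimeTo n))

2*suc/1 : ∀ n → (+ (2 * suc n)) ℚ./ 1 ≡ 1ℚ ℚ.+ (1ℚ ℚ.+ (+ (2 * n)) ℚ./ 1)
2*suc/1 n = begin
  (+ (2 * suc n)) ℚ./ 1                        ≡⟨ ≡.cong (λ m → (+ suc m) ℚ./ 1) (ℕₚ.+-suc n (n ℕ.+ 0)) ⟩
  (+ suc (suc (2 * n))) ℚ./ 1                  ≡⟨ suc/1 (suc (2 * n)) ⟩
  1ℚ ℚ.+ (+ suc (2 * n)) ℚ./ 1                 ≡⟨ ≡.cong (1ℚ ℚ.+_) (suc/1 (2 * n)) ⟩
  1ℚ ℚ.+ (1ℚ ℚ.+ (+ (2 * n)) ℚ./ 1)            ∎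
  where open ≡.≡-Reasoning

energy-2n : ∀ n (z : Vector ℂ n) → (∀ u → UnitRe (z u)) →
  ∑ℝ {n * 2} (λ a → ∣ re (eigenvalue z (remQuot 2 a)) ∣ℝ) ≐ fromℕℝ (2 * n)
energy-2n zero    z unit N = ≡.refl
energy-2n (suc n) z unit N = begin
  ℚ.∣ q ℚ.+ 1ℚ ∣ ℚ.+ (ℚ.∣ q ℚ.- 1ℚ ∣ ℚ.+ rest)
    ≡⟨ ℚₚ.+-assoc ℚ.∣ q ℚ.+ 1ℚ ∣ ℚ.∣ q ℚ.- 1ℚ ∣ rest ⟨
  (ℚ.∣ q ℚ.+ 1ℚ ∣ ℚ.+ ℚ.∣ q ℚ.- 1ℚ ∣) ℚ.+ rest
    ≡⟨ ≡.cong₂ ℚ._+_ (∣q+1∣+∣q-1∣ q (unit zero N)) (energy-2n n (λ u → z (suc u)) (λ u → unit (suc u)) N) ⟩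
  (1ℚ ℚ.+ 1ℚ) ℚ.+ (+ (2 * n)) ℚ./ 1
    ≡⟨ ℚₚ.+-assoc 1ℚ 1ℚ ((+ (2 * n)) ℚ./ 1) ⟩
  1ℚ ℚ.+ (1ℚ ℚ.+ (+ (2 * n)) ℚ./ 1)
    ≡⟨ 2*suc/1 n ⟨
  (+ (2 * suc n)) ℚ./ 1 ∎
  where
  open ≡.≡-Reasoning
  q rest : ℚ
  q = seq (re (z zero)) N
  rest = seq (∑ℝ {n * 2} (λ a → ∣ re (eigenvalue (λ u → z (suc u)) (remQuot 2 a)) ∣ℝ)) N

unitSpectrum⇒hasEnergy : ∀ {n} {S : Sidigraph n} →
  ∃[ z ] Spectral S z × (∀ u → UnitRe (z u)) → HasEnergy (S □ K₂) (fromℕℝ (2 * n))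
unitSpectrum⇒hasEnergy {n} {S} (z , spec , unit) =
  (λ a → eigenvalue z (remQuot 2 a)) , spectral⇒isSpectrum {n} {S} {z} spec , 
  ≐⇒≈ℝ (∑ℝ {n * 2} (λ a → ∣ re (eigenvalue z (remQuot 2 a)) ∣ℝ)) (fromℕℝ (2 * n)) (energy-2n n z unit)

-- Explicit cube and fourth roots of -1

0≤¼ : 0ℚ ℚ.≤ ½ ℚ.* ½
0≤¼ = ℚₚ.≤ᵇ⇒≤ _

¼≤½ : ½ ℚ.* ½ ℚ.≤ ½
¼≤½ = ℚₚ.≤ᵇ⇒≤ _

0≤½ : 0ℚ ℚ.≤ ½
0≤½ = ℚₚ.≤ᵇ⇒≤ _

-- `SquareRoot` yields the root of 1 - c, so c is ¼ in the first case and ½ in the second.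
√¾ √½ : ℝ
√¾ = SquareRoot.√ (½ ℚ.* ½) 0≤¼ ¼≤½
√½ = SquareRoot.√ ½ 0≤½ ℚₚ.≤-refl

√¾*√¾ : √¾ *ℝ √¾ ≈ℝ fromℚ (1ℚ ℚ.- ½ ℚ.* ½)
√¾*√¾ = SquareRoot.√*√ (½ ℚ.* ½) 0≤¼ ¼≤½

√½*√½ : √½ *ℝ √½ ≈ℝ fromℚ ½
√½*√½ = SquareRoot.√*√ ½ 0≤½ ℚₚ.≤-refl

-- ω is e^(iπ/3), ζ is e^(iπ/4) and ξ is the conjugate of ζ, so that ζ² = i and ξ² = -i.
ω ζ ξ : ℂ
ω = fromℚ ½ +i √¾
ζ = √½ +i √½
ξ = √½ +i (-ℝ √½)

ω⊗[1⊝ω] : ω ⊗ (1ℂ ⊝ ω) ≈ 1ℂ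
ω⊗[1⊝ω] =
    ≈ℝ-trans {re (ω ⊗ (1ℂ ⊝ ω))} {√¾ *ℝ √¾ +ℝ fromℚ (½ ℚ.* ½)} {1ℝ}
      (≐⇒≈ℝ (re (ω ⊗ (1ℂ ⊝ ω))) (√¾ *ℝ √¾ +ℝ fromℚ (½ ℚ.* ½)) λ n →
        solve 1 (λ t → con ½ :* (con 1ℚ :- con ½) :- t :* (con 0ℚ :- t) := t :* t :+ con (½ ℚ.* ½)) ≡.refl (seq √¾ n))
      (+ℝ-cong (√¾ *ℝ √¾) (fromℚ (1ℚ ℚ.- ½ ℚ.* ½)) (fromℚ (½ ℚ.* ½)) (fromℚ (½ ℚ.* ½)) √¾*√¾ (≈ℝ-refl {fromℚ (½ ℚ.* ½)}))
  , ≐⇒≈ℝ (im (ω ⊗ (1ℂ ⊝ ω))) 0ℝ λ n →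
      solve 1 (λ t → con ½ :* (con 0ℚ :- t) :+ t :* (con 1ℚ :- con ½) := con 0ℚ) ≡.refl (seq √¾ n)
  where open +-*-Solver

ζ²+ξ² : (ζ ⊗ ζ) ⊕ (ξ ⊗ ξ) ≈ 0ℂ
ζ²+ξ² = ≐⇒≈ℂ ((ζ ⊗ ζ) ⊕ (ξ ⊗ ξ)) 0ℂ
  (λ n → solve 1 (λ r → (r :* r :- r :* r) :+ (r :* r :- (:- r) :* (:- r)) := con 0ℚ) ≡.refl (seq √½ n))
  (λ n → solve 1 (λ r → (r :* r :+ r :* r) :+ (r :* (:- r) :+ (:- r) :* r) := con 0ℚ) ≡.refl (seq √½ n))
  where open +-*-Solver

ζ²ξ² : (ζ ⊗ ζ) ⊗ (ξ ⊗ ξ) ≈ 1ℂ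
ζ²ξ² =
    ≈ℝ-trans {re ((ζ ⊗ ζ) ⊗ (ξ ⊗ ξ))} {2r² *ℝ 2r²} {1ℝ}
      (≐⇒≈ℝ (re ((ζ ⊗ ζ) ⊗ (ξ ⊗ ξ))) (2r² *ℝ 2r²) λ n →
        solve 1 (λ r → (r :* r :- r :* r) :* (r :* r :- (:- r) :* (:- r)) :- (r :* r :+ r :* r) :* (r :* (:- r) :+ (:- r) :* r)
          := (r :* r :+ r :* r) :* (r :* r :+ r :* r)) ≡.refl (seq √½ n))
      (*ℝ-cong 2r² 1ℝ 2r² 1ℝ 2r²≈1 2r²≈1)
  , ≐⇒≈ℝ (im ((ζ ⊗ ζ) ⊗ (ξ ⊗ ξ))) 0ℝ λ n →
      solve 1 (λ r → (r :* r :- r :* r) :* (r :* (:- r) :+ (:- r) :* r) :+ (r :* r :+ r :* r) :* (r :* r :- (:- r) :* (:- r))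
        := con 0ℚ) ≡.refl (seq √½ n)
  where
  open +-*-Solver
  2r² : ℝ
  2r² = √½ *ℝ √½ +ℝ √½ *ℝ √½
  2r²≈1 : 2r² ≈ℝ 1ℝ
  2r²≈1 = +ℝ-cong (√½ *ℝ √½) (fromℚ ½) (√½ *ℝ √½) (fromℚ ½) √½*√½ √½*√½

-1≤0 : ℚ.- 1ℚ ℚ.≤ 0ℚ
-1≤0 = ℚₚ.≤ᵇ⇒≤ _

0≤1 : 0ℚ ℚ.≤ 1ℚ
0≤1 = ℚₚ.≤ᵇ⇒≤ _

unitRe-√½ : UnitRe ζ
unitRe-√½ n = ℚₚ.≤-trans -1≤0 (SquareRoot.0≤√ ½ 0≤½ ℚₚ.≤-refl n) , SquareRoot.√≤1 ½ 0≤½ ℚₚ.≤-refl n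

unitRe-⊖ : ∀ z → UnitRe z → UnitRe (⊖ z)
unitRe-⊖ z unit n = ℚₚ.neg-antimono-≤ (proj₂ (unit n)) , ℚₚ.neg-antimono-≤ (proj₁ (unit n))

unitRe-0 : UnitRe 0ℂ
unitRe-0 n = -1≤0 , 0≤1

roots³ : Vector ℂ 3
roots³ = ⊖ 1ℂ ∷ ω ∷ 1ℂ ⊝ ω ∷ []

-- The real parts -1, ½ and ½ are constant sequences, so the bounds are closed rational
-- inequalities.
unitRe³ : ∀ i → UnitRe (roots³ i)
unitRe³ zero             n = ℚₚ.≤-refl , ℚₚ.≤ᵇ⇒≤ _
unitRe³ (suc zero)       n = ℚₚ.≤ᵇ⇒≤ _ , ℚₚ.≤ᵇ⇒≤ _
unitRe³ (suc (suc zero)) n = ℚₚ.≤ᵇ⇒≤ _ , ℚₚ.≤ᵇ⇒≤ _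

roots⁴ : Vector ℂ 4
roots⁴ = ζ ∷ ⊖ ζ ∷ ξ ∷ ⊖ ξ ∷ []

unitRe⁴ : ∀ i → UnitRe (roots⁴ i)
unitRe⁴ zero                   = unitRe-√½
unitRe⁴ (suc zero)             = unitRe-⊖ ζ unitRe-√½
-- ξ and ζ have the same real part, and `UnitRe` looks at nothing else.
unitRe⁴ (suc (suc zero))       = unitRe-√½
unitRe⁴ (suc (suc (suc zero))) = unitRe-⊖ ζ unitRe-√½

pathCycle³-hasEnergy : ∀ {n} {S : Sidigraph n} → PathCycle 3 S → HasEnergy (S □ K₂) (fromℕℝ (2 * n))
pathCycle³-hasEnergy {S = S} path³ = unitSpectrum⇒hasEnergy {S = S}
  (pathCycle-spectral {w = roots³} UnitRe (λ ρ neg → spectral-cycle³ ρ neg ω ω⊗[1⊝ω]) unitRe-0 unitRe³ path³)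

pathCycle⁴-hasEnergy : ∀ {n} {T : Sidigraph n} → PathCycle 4 T → HasEnergy (T □ K₂) (fromℕℝ (2 * n))
pathCycle⁴-hasEnergy {T = T} path⁴ = unitSpectrum⇒hasEnergy {S = T}
  (pathCycle-spectral {w = roots⁴} UnitRe (λ ρ neg → spectral-cycle⁴ ρ neg ζ ξ ζ²+ξ² ζ²ξ²) unitRe-0 unitRe⁴ path⁴)

4≉0 : ¬ (1ℂ ⊕ 1ℂ) ⊗ (1ℂ ⊕ 1ℂ) ≈ 0ℂ
4≉0 (re≈0 , _) with N , 4<1 ← re≈0 1ℚ (ℚₚ.positive⁻¹ 1ℚ) =
  from-no (ℚ.∣ (1ℚ ℚ.+ 1ℚ) ℚ.* (1ℚ ℚ.+ 1ℚ) ∣ ℚₚ.<? 1ℚ) (4<1 N ℕₚ.≤-refl)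

¬cospectral : ∀ {n} {S T : Sidigraph n} → PathCycle 3 S → PathCycle 4 T → ¬ Cospectral (S □ K₂) (T □ K₂)
¬cospectral {S = S} {T} path³ path⁴ (zs , specS , specT) =
  4≉0 (cospectral⇒4≈0 {S = S} {T} {zs} path³ path⁴ specS specT)

corollary6p4 : (n : ℕ) → 5 ≤ n →
    (S T : Sidigraph n) → PathCycle 3 S → PathCycle 4 T →
    (¬ Cospectral (S □ K₂) (T □ K₂))
    × Equienergetic (S □ K₂) (T □ K₂)
    × (order (S □ K₂) ≡ 2 * n)
    × (order (T □ K₂) ≡ 2 * n)
    × HasEnergy (S □ K₂) (fromℕℝ (2 * n))
    × HasEnergy (T □ K₂) (fromℕℝ (2 * n))
corollary6p4 n _ S T path³ path⁴ =
    ¬cospectral path³ path⁴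
  , ( pathCycle³□K₂≇pathCycle⁴□K₂ path³ path⁴
    , fromℕℝ (2 * n) , pathCycle³-hasEnergy path³ , pathCycle⁴-hasEnergy path⁴ )
  , ℕₚ.*-comm n 2
  , ℕₚ.*-comm n 2
  , pathCycle³-hasEnergy path³
  , pathCycle⁴-hasEnergy path⁴
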